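{- Let $R$ be a commutative associative ring with $1$, let $a,b\in R$, and let $m$ be a positive integer. Let $D_{2m}(a,b)$ be the symmetric Toeplitz matrix of order $2m$ over $R$ with first row $(0,a,a,b,\dots,b)$; that is, the $(i,j)$ entry is $0$ if $i=j$, is $a$ if $|i-j|\in\{1,2\}$, and is $b$ otherwise. With the convention $0^0=1$, $$ \mathrm{Hf}(D_{2m}(a,b))=\sum_{k=0}^m (a-b)^{m-k}\,b^k\,\frac{(2k)!}{k!\,2^k}\,\mu_{m-k}(\Gamma(D_{2m})), $$ where $\mu_{m-k}(\Gamma(D_{2m}))$, the number of $(m-k)$-edge matchings in the graph $\Gamma(D_{2m})$, is given by $$ \mu_{m-k}(\Gamma(D_{2m}))=\sum_{i=0}^{\min\left(m-k,\left\lfloor \frac{m+k}{2}\right\rfloor\right)}\ \sum_{p=\max(0,i-2k)}^{\min(i,m-k-i)}\binom{m+k-i}{m-k-p}\binom{m-k-p}{i}\binom{i}{p}. $$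
   Context: For a symmetric matrix $A=(a_{ij})$ of even order $n$ over a commutative associative ring, the hafnian of $A$ is $$\mathrm{Hf}(A)=\sum_{(i_1i_2|\dots|i_{n-1}i_n)} a_{i_1i_2}\cdots a_{i_{n-1}i_n},$$ where the sum ranges over all unordered partitions of the set $\{1,2,\dots,n\}$ into unordered pairs $(i_1i_2),\dots,(i_{n-1}i_n)$. The numbers $\frac{(2k)!}{k!\,2^k}$ are integers; integers act on $R$ in the usual way (as integer multiples). The convention $0^0=1$ means $x^0=1$ for every $x\in R$, including $x=0$. $D_n$ denotes the symmetric Toeplitz $(0,1)$-matrix of order $n$ with first row $(0,1,1,0,\dots,0)$, and $\Gamma(D_n)$ is the simple graph with adjacency matrix $D_n$: its vertices are $1,\dots,n$, and distinct vertices $i,j$ are adjacent iff $|i-j|\in\{1,2\}$. A $k$-edge matching in a graph is a set of $k$ pairwise nonadjacent edges (no two share a vertex). $\mu_k(\Gamma)$ denotes the number of $k$-edge matchings of the graph $\Gamma$, with $\mu_0(\Gamma)=1$. -}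

module Defs where

open import Algebra.Bundles using (CommutativeRing; Monoid)
open import Data.Fin.Base as Fin using (Fin; toℕ)
import Data.Fin.Properties as Fin
open import Data.List.Base
  using (List; []; _∷_; _++_; map; foldr; filter; length; allFin; cartesianProduct)
open import Data.List.Relation.Unary.AllPairs using (AllPairs; allPairs?)
open import Data.List.Relation.Unary.Any using (Any; any?)
open import Data.Nat.Base
  using (ℕ; suc; _+_; _*_; _∸_; _^_; _/_; _!; ∣_-_∣; NonZero)
open import Data.Nat.Properties
  using (+-0-monoid; ∣-∣-comm; ∣n-n∣≡0; m*n≢0; m^n≢0; _!≢0)
  renaming (_≟_ to _≟ℕ_)
open import Algebra.Definitions.RawMonoid (Monoid.rawMonoid +-0-monoid)
  using (sum)
open import Data.Product.Base using (_×_; _,_; uncurry)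
open import Data.Sum.Base using (_⊎_)
open import Relation.Binary.Definitions using (Decidable; Irreflexive; Symmetric)
open import Relation.Binary.PropositionalEquality
  using (_≡_; _≢_; refl; sym; trans; cong)
open import Relation.Nullary.Decidable using (¬?; _×-dec_; _⊎-dec_)
import Relation.Unary as U

-- The sublists of xs; when xs has no repetitions these are the subsets of its
-- set of entries, each listed exactly once.
sublists : ∀ {a} {A : Set a} → List A → List (List A)
sublists []       = [] ∷ []
sublists (x ∷ xs) = map (x ∷_) (sublists xs) ++ sublists xs

-- Σ_{i=lo}^{hi} f i, empty (hence 0) when hi < lo.
sumFromTo : ℕ → ℕ → (ℕ → ℕ) → ℕ
sumFromTo lo hi f = sum {suc hi ∸ lo} λ j → f (lo + toℕ j)

infixr 5 sumFromTo

syntax sumFromTo lo hi (λ i → e) = ∑[ i ∈ lo ⋯ hi ] e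

Pair : ℕ → Set
Pair n = Fin n × Fin n

-- An unordered pair {i , j} with i ≢ j is represented by (i , j) with i < j.
unorderedPairs : ∀ n → List (Pair n)
unorderedPairs n =
  filter (λ (i , j) → i Fin.<? j) (cartesianProduct (allFin n) (allFin n))

module _ {n : ℕ} where

  _∈ₚ_ : Fin n → Pair n → Set
  v ∈ₚ (i , j) = v ≡ i ⊎ v ≡ j

  Disjoint : Pair n → Pair n → Set
  Disjoint (i , j) (k , l) = (i ≢ k × i ≢ l) × (j ≢ k × j ≢ l)

  _∈ₚ?_ : Decidable _∈ₚ_
  v ∈ₚ? (i , j) = (v Fin.≟ i) ⊎-dec (v Fin.≟ j)

  disjoint? : Decidable Disjoint
  disjoint? (i , j) (k , l) =
    (¬? (i Fin.≟ k) ×-dec ¬? (i Fin.≟ l)) ×-dec (¬? (j Fin.≟ k) ×-dec ¬? (j Fin.≟ l))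

  IsPartition : List (Pair n) → Set
  IsPartition ps = AllPairs Disjoint ps × (∀ v → Any (v ∈ₚ_) ps)

  isPartition? : U.Decidable IsPartition
  isPartition? ps = allPairs? disjoint? ps ×-dec Fin.all? (λ v → any? (v ∈ₚ?_) ps)

pairPartitions : ∀ n → List (List (Pair n))
pairPartitions n = filter isPartition? (sublists (unorderedPairs n))

Matrix : ∀ {a} → Set a → ℕ → Set a
Matrix A n = Fin n → Fin n → A

-- The symmetric Toeplitz matrix whose first row is r 0, …, r (n - 1).
toeplitz : ∀ {a} {A : Set a} (n : ℕ) → (ℕ → A) → Matrix A n
toeplitz n r i j = r ∣ toℕ i - toℕ j ∣

-- The first row (z, a, a, b, b, …).
firstRow : ∀ {a} {A : Set a} → A → A → A → ℕ → A
firstRow z a b 0                   = z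
firstRow z a b 1                   = a
firstRow z a b 2                   = a
firstRow z a b (suc (suc (suc _))) = b

module _ {c ℓ} (R : CommutativeRing c ℓ) where
  private module R = CommutativeRing R

  -- Only meaningful for symmetric A: each unordered pair {i , j} contributes the
  -- entry A i j with i < j.
  hafnian : ∀ {n} → Matrix R.Carrier n → R.Carrier
  hafnian {n} A = foldr R._+_ R.0# (map weight (pairPartitions n))
    where
    weight : List (Pair n) → R.Carrier
    weight ps = foldr R._*_ R.1# (map (uncurry A) ps)

  D[_,_] : R.Carrier → R.Carrier → ∀ n → Matrix R.Carrier n
  D[ a , b ] n = toeplitz n (firstRow R.0# a b)

D : ∀ n → Matrix ℕ n
D n = toeplitz n (firstRow 0 1 0)

record SimpleGraph (n : ℕ) : Set₁ where
  field
    Adj    : Fin n → Fin n → Set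
    adj?   : Decidable Adj
    symm   : Symmetric Adj
    irrefl : Irreflexive _≡_ Adj

  edges : List (Pair n)
  edges = filter (λ (i , j) → adj? i j) (unorderedPairs n)

-- The number of k-edge matchings.
μ : ∀ {n} → ℕ → SimpleGraph n → ℕ
μ k G = length (filter (λ es → (length es ≟ℕ k) ×-dec allPairs? disjoint? es)
                       (sublists (SimpleGraph.edges G)))

-- The graph with a given adjacency matrix.
graph : ∀ {n} (A : Matrix ℕ n) → (∀ i j → A i j ≡ A j i) → (∀ i → A i i ≡ 0) →
        SimpleGraph n
graph A A-sym A-diag = record
  { Adj    = λ i j → A i j ≡ 1
  ; adj?   = λ i j → A i j ≟ℕ 1
  ; symm   = λ {i} {j} p → trans (A-sym j i) p
  ; irrefl = λ { {i} refl p → 0≢1 (trans (sym (A-diag i)) p) }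
  }
  where
  0≢1 : 0 ≢ 1
  0≢1 ()

ΓD : ∀ n → SimpleGraph n
ΓD n = graph (D n)
  (λ i j → cong (firstRow 0 1 0) (∣-∣-comm (toℕ i) (toℕ j)))
  (λ i → cong (firstRow 0 1 0) (∣n-n∣≡0 (toℕ i)))

-- (2k)! / (k! 2ᵏ); the division is exact.
pairings : ℕ → ℕ
pairings k = (2 * k) ! / (k ! * 2 ^ k)
  where
  instance
    k!2^k≢0 : NonZero (k ! * 2 ^ k)
    k!2^k≢0 = m*n≢0 (k !) (2 ^ k) {{k !≢0}} {{m^n≢0 2 k}}

{-# OPTIONS --safe #-}

-- Write every entry b of the matrix as b + 0 and every entry a as b + (a - b), and expand.  A
-- perfect matching then contributes one term for each choice of a matching of Γ inside it, and
-- the 2k vertices left by an (m - k)-edge matching can be paired off in (2k)! / (k! 2ᵏ) ways.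
-- Both kinds of matching are counted over vertex lists by removing the first vertex.  For Γ, the
-- square of a path, this gives a recurrence with a four-term right-hand side; it is the one
-- satisfied by the tilings of the path with tiles of sizes 1, 2, 3, 4 carrying 0, 1, 1, 2 edges,
-- whose number by tile type is a product of three binomial coefficients.
module Submission where

open import Defs
open import Algebra.Bundles using (CommutativeRing; CommutativeSemiring)
open import Data.Empty using (⊥)
open import Data.Fin.Base as Fin using (Fin; toℕ; zero; suc)
open import Data.List.Base using (List; []; _∷_; _++_; allFin; cartesianProduct; filter; foldr; length; lookup; map; tabulate)
open import Data.List.Membership.Propositional using (_∈_)
open import Data.List.Membership.Propositional.Properties using (∈-lookup)
open import Data.List.Properties using (filter-++; filter-accept; filter-all; filter-none; filter-reject; length-tabulate; map-tabulate; map-∘)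
open import Data.List.Relation.Unary.All as All using (All; []; _∷_)
open import Data.List.Relation.Unary.AllPairs using (AllPairs; []; _∷_; allPairs?)
open import Data.List.Relation.Unary.Any as Any using (Any; here; there)
open import Data.List.Relation.Unary.Any.Properties using (lookup-index)
open import Data.List.Relation.Unary.Unique.Propositional using (Unique)
open import Data.Nat.Base as ℕ using (ℕ; zero; suc; NonZero; _∸_; _≤_; _<_; z≤n; s≤s; _⊓_; _/_; _!; ∣_-_∣)
open import Data.Nat.Combinatorics using (_C_; nCk+nC[k+1]≡[n+1]C[k+1]; k>n⇒nCk≡0)
open import Data.Nat.DivMod using (m*n/n≡m; m/n≤m; /-congˡ; /-monoˡ-≤)
open import Data.Nat.Solver using (module +-*-Solver)
open import Data.Product.Base using (_×_; _,_; proj₁; proj₂; uncurry)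
open import Data.Sum.Base using (_⊎_; inj₁; inj₂)
open import Function.Base using (_∘_; id)
open import Function.Bundles using (_⇔_; mk⇔; Equivalence)
open import Function.Definitions using (Injective)
open import Relation.Binary.PropositionalEquality as ≡ using (_≡_; _≢_)
open import Relation.Nullary.Decidable using (¬?; _×-dec_; yes; no)
open import Relation.Nullary.Negation using (¬_; contradiction)
open import Relation.Unary using (Decidable)
import Algebra.Properties.AbelianGroup as AbelianGroup
import Algebra.Properties.CommutativeMonoid.Mult as CommutativeMult
import Algebra.Properties.CommutativeSemigroup as CommutativeSemigroup
import Algebra.Properties.Monoid.Mult as Mult
import Algebra.Properties.Monoid.Sum as Sum
import Algebra.Properties.Semiring.Exp as Exp
import Algebra.Properties.Semiring.Mult as SemiringMult
import Data.Fin.Properties as Fin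
import Data.List.Relation.Unary.All.Properties as All
import Data.List.Relation.Unary.AllPairs.Properties as AllPairs
import Data.List.Relation.Unary.Unique.Propositional.Properties as Unique
import Data.Nat.Properties as ℕ
import Relation.Binary.Reasoning.Setoid as SetoidReasoning

-- Weighted sums of matchings over a list of vertices

-- Giving the first vertex a partner leaves a list with a hole, so a recursion on consecutive
-- vertices does not close by itself. In the square of a path the only hole that arises is one
-- missing vertex right after the first; that first vertex then has a single possible partner, and
-- one further step returns to consecutive lists. Tiles of size 1, 2, 3, 4 have 1, 1, 2, 2 more
-- vertices than edges. Indexing the tilings by the number j of edges and the excess s of vertices
-- over edges turns both sums of the closed formula into sums over antidiagonals, i + N = s and p +
-- q = j, with no subtraction. The bounds on i and p cut off only terms in which some binomial
-- coefficient vanishes. In the expansion of the hafnian no sub-matching is chosen in advance: the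
-- induction splits only the edge at the first vertex, and a double count of uncovered vertices
-- supplies the odd factors whose product is (2k)! / (k! 2^k).

oddFactorial : ℕ → ℕ
oddFactorial zero    = 1
oddFactorial (suc k) = suc (2 ℕ.* k) ℕ.* oddFactorial k

[2k]!≡oddFactorial*k!*2^k : ∀ k → (2 ℕ.* k) ! ≡ oddFactorial k ℕ.* (k ! ℕ.* 2 ℕ.^ k)
[2k]!≡oddFactorial*k!*2^k zero    = ≡.refl
[2k]!≡oddFactorial*k!*2^k (suc k) = begin
  (2 ℕ.* suc k) !                           ≡⟨ ≡.cong _! (ℕ.*-suc 2 k) ⟩
  (2 ℕ.+ 2 ℕ.* k) ℕ.* (suc (2 ℕ.* k) ℕ.* (2 ℕ.* k) !)
    ≡⟨ ≡.cong (λ x → (2 ℕ.+ 2 ℕ.* k) ℕ.* (suc (2 ℕ.* k) ℕ.* x)) ([2k]!≡oddFactorial*k!*2^k k) ⟩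
  (2 ℕ.+ 2 ℕ.* k) ℕ.* (suc (2 ℕ.* k) ℕ.* (oddFactorial k ℕ.* (k ! ℕ.* 2 ℕ.^ k)))
    ≡⟨ regroup k (oddFactorial k) (k !) (2 ℕ.^ k) ⟩
  oddFactorial (suc k) ℕ.* (suc k ! ℕ.* 2 ℕ.^ suc k) ∎
  where
  open ≡.≡-Reasoning
  open +-*-Solver
  regroup : ∀ k o f e → (2 ℕ.+ 2 ℕ.* k) ℕ.* (suc (2 ℕ.* k) ℕ.* (o ℕ.* (f ℕ.* e))) ≡
            suc (2 ℕ.* k) ℕ.* o ℕ.* (suc k ℕ.* f ℕ.* (2 ℕ.* e))
  regroup = solve 4 (λ k o f e →
    (con 2 :+ con 2 :* k) :* ((con 1 :+ con 2 :* k) :* (o :* (f :* e))) :=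
    (con 1 :+ con 2 :* k) :* o :* ((con 1 :+ k) :* f :* (con 2 :* e))) ≡.refl

-- `oddFactorial k` is the double factorial (2k - 1)!!. Its recursion is free of division and is the
-- one that the induction in `matchSum-perfect` produces.
pairings≡oddFactorial : ∀ k → pairings k ≡ oddFactorial k
pairings≡oddFactorial k = ≡.trans (/-congˡ ([2k]!≡oddFactorial*k!*2^k k))
  (m*n/n≡m (oddFactorial k) (k ! ℕ.* 2 ℕ.^ k))
  where
  instance
    k!2^k≢0 : NonZero (k ! ℕ.* 2 ℕ.^ k)
    k!2^k≢0 = ℕ.m*n≢0 (k !) (2 ℕ.^ k) {{k ℕ.!≢0}} {{ℕ.m^n≢0 2 k}}

-- Sums over an antidiagonal

module Antidiagonal {c ℓ} (S : CommutativeSemiring c ℓ) where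
  open CommutativeSemiring S hiding (zero)
  open CommutativeSemigroup +-commutativeSemigroup using (interchange)
  open Sum +-monoid using (sum⁺-syntax)

  -- Carrying both indices, in place of i and n ∸ i, makes index shifts hold by computation and lets
  -- `anti-cong` hand over the equation i + j ≡ n.
  anti : (ℕ → ℕ → Carrier) → ℕ → Carrier
  anti f zero    = f 0 0
  anti f (suc n) = f 0 (suc n) + anti (λ i → f (suc i)) n

  anti-cong : ∀ {f g} n → (∀ i j → i ℕ.+ j ≡ n → f i j ≈ g i j) → anti f n ≈ anti g n
  anti-cong zero    eq = eq 0 0 ≡.refl
  anti-cong (suc n) eq =
    +-cong (eq 0 (suc n) ≡.refl) (anti-cong n λ i j p → eq (suc i) j (≡.cong suc p))

  anti-+ : ∀ f g n → anti (λ i j → f i j + g i j) n ≈ anti f n + anti g n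
  anti-+ f g zero    = refl
  anti-+ f g (suc n) =
    trans (+-congˡ (anti-+ (λ i → f (suc i)) (λ i → g (suc i)) n)) (interchange _ _ _ _)

  anti-snoc : ∀ f n → anti f (suc n) ≈ anti (λ i j → f i (suc j)) n + f (suc n) 0
  anti-snoc f zero    = refl
  anti-snoc f (suc n) =
    trans (+-congˡ (anti-snoc (λ i → f (suc i)) n)) (sym (+-assoc _ _ _))

  anti-zeroʳ : ∀ f n → (∀ i → f i 0 ≈ 0#) → anti f (suc n) ≈ anti (λ i j → f i (suc j)) n
  anti-zeroʳ f n f0≈0 =
    trans (anti-snoc f n) (trans (+-congˡ (f0≈0 (suc n))) (+-identityʳ _))

  anti-*ˡ : ∀ x f n → anti (λ i j → x * f i j) n ≈ x * anti f n
  anti-*ˡ x f zero    = refl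
  anti-*ˡ x f (suc n) = trans (+-congˡ (anti-*ˡ x _ n)) (sym (distribˡ _ _ _))

  anti-0 : ∀ f n → (∀ i j → f i j ≈ 0#) → anti f n ≈ 0#
  anti-0 f zero    f≈0 = f≈0 0 0
  anti-0 f (suc n) f≈0 = trans (+-cong (f≈0 0 (suc n)) (anti-0 _ n λ i → f≈0 (suc i))) (+-identityˡ 0#)

  ∑≈anti : ∀ f n → (∑[ k ≤ n ] f (toℕ k) (n ∸ toℕ k)) ≈ anti f n
  ∑≈anti f zero    = +-identityʳ _
  ∑≈anti f (suc n) = +-congˡ (∑≈anti (λ i → f (suc i)) n)

module Matchings {c ℓ} (S : CommutativeSemiring c ℓ) {v} {V : Set v} where
  open CommutativeSemiring S hiding (zero)
  open SetoidReasoning setoid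
  open CommutativeSemigroup +-commutativeSemigroup using (interchange; x∙yz≈y∙xz)
  open SemiringMult semiring using (×-congˡ; ×-congʳ; ×-comm-*; ×-assoc-*; ×-assocˡ) renaming (_×_ to _·_)
  open CommutativeMult +-commutativeMonoid using (×-distrib-+)
  open Exp semiring using (_^_)
  open Antidiagonal S

  -- Positions are picked, not values, so neither decidable equality nor absence of repetitions is
  -- assumed; the skipped entries accumulate in the continuation.
  pickSum : (V → List V → Carrier) → List V → Carrier
  pickSum f []       = 0#
  pickSum f (u ∷ us) = f u us + pickSum (λ t ts → f t (u ∷ ts)) us

  pickSum-cong : ∀ {f g} vs → (∀ u us → suc (length us) ≡ length vs → f u us ≈ g u us) →
                 pickSum f vs ≈ pickSum g vs
  pickSum-cong []       eq = refl
  pickSum-cong (v ∷ vs) eq =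
    +-cong (eq v vs ≡.refl) (pickSum-cong vs λ u us p → eq u (v ∷ us) (≡.cong suc p))

  pickSum-+ : ∀ f g vs → pickSum (λ u us → f u us + g u us) vs ≈ pickSum f vs + pickSum g vs
  pickSum-+ f g []       = sym (+-identityˡ 0#)
  pickSum-+ f g (v ∷ vs) = trans (+-congˡ (pickSum-+ _ _ vs)) (interchange _ _ _ _)

  pickSum-*ˡ : ∀ x f vs → pickSum (λ u us → x * f u us) vs ≈ x * pickSum f vs
  pickSum-*ˡ x f []       = sym (zeroʳ x)
  pickSum-*ˡ x f (v ∷ vs) = trans (+-congˡ (pickSum-*ˡ x _ vs)) (sym (distribˡ x _ _))

  pickSum-· : ∀ n f vs → pickSum (λ u us → n · f u us) vs ≈ n · pickSum f vs
  pickSum-· zero    f []       = refl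
  pickSum-· (suc n) f []       = trans (pickSum-· n f []) (sym (+-identityˡ _))
  pickSum-· n       f (v ∷ vs) = trans (+-congˡ (pickSum-· n _ vs)) (sym (×-distrib-+ _ _ n))

  pickSum-0 : ∀ vs → pickSum (λ _ _ → 0#) vs ≈ 0#
  pickSum-0 []       = refl
  pickSum-0 (v ∷ vs) = trans (+-identityˡ _) (pickSum-0 vs)

  pickSum-1 : ∀ vs → pickSum (λ _ _ → 1#) vs ≈ length vs · 1#
  pickSum-1 []       = refl
  pickSum-1 (v ∷ vs) = +-congˡ (pickSum-1 vs)

  pickSum-anti : ∀ (f : V → List V → ℕ → ℕ → Carrier) n vs →
    pickSum (λ u us → anti (f u us) n) vs ≈ anti (λ i j → pickSum (λ u us → f u us i j) vs) n
  pickSum-anti f zero    vs = refl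
  pickSum-anti f (suc n) vs =
    trans (pickSum-+ _ _ vs) (+-congˡ (pickSum-anti (λ u us i → f u us (suc i)) n vs))

  -- Both sides range over the ordered choices of two different positions, and the list that remains
  -- does not depend on which was removed first.
  pickSum-swap : ∀ (f : V → V → List V → Carrier) vs →
    pickSum (λ u → pickSum (f u)) vs ≈ pickSum (λ t → pickSum (λ u → f u t)) vs
  pickSum-swap f []       = refl
  pickSum-swap f (v ∷ vs) = begin
    pickSum (f v) vs + pickSum (λ u us → f u v us + pickSum (λ t ts → f u t (v ∷ ts)) us) vs
      ≈⟨ +-congˡ (pickSum-+ _ _ vs) ⟩
    pickSum (f v) vs + (pickSum (λ u → f u v) vs + pickSum (λ u → pickSum (λ t ts → f u t (v ∷ ts))) vs)
      ≈⟨ +-congˡ (+-congˡ (pickSum-swap (λ u t ts → f u t (v ∷ ts)) vs)) ⟩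
    pickSum (f v) vs + (pickSum (λ u → f u v) vs + pickSum (λ t → pickSum (λ u us → f u t (v ∷ us))) vs)
      ≈⟨ x∙yz≈y∙xz _ _ _ ⟩
    pickSum (λ u → f u v) vs + (pickSum (f v) vs + pickSum (λ t → pickSum (λ u us → f u t (v ∷ us))) vs)
      ≈⟨ +-congˡ (pickSum-+ _ _ vs) ⟨
    pickSum (λ u → f u v) vs + pickSum (λ t ts → f v t ts + pickSum (λ u us → f u t (v ∷ us)) ts) vs ∎

  Weight : Set _
  Weight = V → V → Carrier

  -- The total weight of the k-edge matchings of the complete graph on vs.
  matchSum : Weight → ℕ → List V → Carrier
  matchSum w zero    vs       = 1#
  matchSum w (suc k) []       = 0#
  matchSum w (suc k) (v ∷ vs) =
    matchSum w (suc k) vs + pickSum (λ u us → w v u * matchSum w k us) vs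

  matchSum-short : ∀ w k vs → length vs < 2 ℕ.* k → matchSum w k vs ≈ 0#
  matchSum-short w (suc k) []       _ = refl
  matchSum-short w (suc k) (v ∷ vs) p = begin
    matchSum w (suc k) vs + pickSum (λ u us → w v u * matchSum w k us) vs
      ≈⟨ +-cong (matchSum-short w (suc k) vs (ℕ.<-trans (ℕ.n<1+n _) p))
           (pickSum-cong vs λ u us q → trans (*-congˡ (matchSum-short w k us (bound us q))) (zeroʳ _)) ⟩
    0# + pickSum (λ _ _ → 0#) vs  ≈⟨ trans (+-identityˡ _) (pickSum-0 vs) ⟩
    0# ∎
    where
    bound : ∀ us → suc (length us) ≡ length vs → length us < 2 ℕ.* k
    bound us q with s≤s (s≤s r) ← ≡.subst₂ _≤_ (≡.cong (λ l → suc (suc l)) (≡.sym q)) (ℕ.*-suc 2 k) p = r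

  -- Double counting: a vertex together with a k-edge matching of the others is a k-edge matching of
  -- `vs` with one of its d uncovered vertices marked.
  pickSum-matchSum : ∀ w k d vs → length vs ≡ 2 ℕ.* k ℕ.+ d →
                     pickSum (λ _ → matchSum w k) vs ≈ d · matchSum w k vs
  pickSum-matchSum w zero    d vs       p = trans (pickSum-1 vs) (×-congˡ p)
  -- No vertex is uncovered when d = 0: deleting any one of 2k + 2 vertices leaves too few for k + 1
  -- edges.
  pickSum-matchSum w (suc k) zero    (v ∷ vs) p = begin
    matchSum w (suc k) vs + pickSum (λ u us → matchSum w (suc k) (v ∷ us)) vs
      ≈⟨ +-congˡ (trans (pickSum-cong vs λ u us q → matchSum-short w (suc k) (v ∷ us)
           (ℕ.≤-reflexive (≡.trans (≡.cong suc q) p′))) (pickSum-0 vs)) ⟩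
    matchSum w (suc k) vs + 0#
      ≈⟨ trans (+-identityʳ _) (matchSum-short w (suc k) vs (ℕ.≤-reflexive p′)) ⟩
    0# ∎
    where
    p′ : suc (length vs) ≡ 2 ℕ.* suc k
    p′ = ≡.trans p (ℕ.+-identityʳ _)
  pickSum-matchSum w (suc k) (suc d) (v ∷ vs) p = begin
    M vs + pickSum (λ u us → M us + pickSum (λ t ts → w v t * matchSum w k ts) us) vs
      ≈⟨ +-congˡ (pickSum-+ _ _ vs) ⟩
    M vs + (pickSum (λ _ → M) vs + pickSum (λ u → pickSum (λ t ts → w v t * matchSum w k ts)) vs)
      ≈⟨ +-congˡ (+-cong (pickSum-matchSum w (suc k) d vs p₁)
           (pickSum-swap (λ _ t ts → w v t * matchSum w k ts) vs)) ⟩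
    -- For matchings that avoid v, marking v itself gives the first summand and marking one of the d
    -- other uncovered vertices gives the second.
    M vs + (d · M vs + pickSum (λ t → pickSum (λ _ ts → w v t * matchSum w k ts)) vs)
      ≈⟨ +-congˡ (+-congˡ (pickSum-cong vs λ t ts q → trans (pickSum-*ˡ _ _ ts)
           (trans (*-congˡ (pickSum-matchSum w k (suc d) ts (p₂ ts q))) (×-comm-* (suc d) _ _)))) ⟩
    M vs + (d · M vs + pickSum (λ t ts → suc d · (w v t * matchSum w k ts)) vs)
      ≈⟨ +-congˡ (+-congˡ (pickSum-· (suc d) _ vs)) ⟩
    M vs + (d · M vs + suc d · pickSum (λ t ts → w v t * matchSum w k ts) vs)
      ≈⟨ +-assoc _ _ _ ⟨
    suc d · M vs + suc d · pickSum (λ t ts → w v t * matchSum w k ts) vs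
      ≈⟨ ×-distrib-+ _ _ (suc d) ⟨
    suc d · matchSum w (suc k) (v ∷ vs) ∎
    where
    M = matchSum w (suc k)
    p₁ : length vs ≡ 2 ℕ.* suc k ℕ.+ d
    p₁ = ℕ.suc-injective (≡.trans p (ℕ.+-suc _ d))
    p₂ : ∀ ts → suc (length ts) ≡ length vs → length ts ≡ 2 ℕ.* k ℕ.+ suc d
    p₂ ts q = ≡.trans (ℕ.suc-injective (≡.trans q (≡.trans p₁ (≡.cong (ℕ._+ d) (ℕ.*-suc 2 k)))))
                (≡.sym (ℕ.+-suc _ d))

  module _ (w w′ : Weight) (b : Carrier) (w≈b+w′ : ∀ u v → w u v ≈ b + w′ u v) where

    private
      coeff : ℕ → Carrier → Carrier
      coeff k x = oddFactorial k · (b ^ k * x)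

      coeff-cong : ∀ k {x y} → x ≈ y → coeff k x ≈ coeff k y
      coeff-cong k eq = ×-congʳ (oddFactorial k) (*-congˡ eq)

      coeff-+ : ∀ k x y → coeff k (x + y) ≈ coeff k x + coeff k y
      coeff-+ k x y =
        trans (×-congʳ (oddFactorial k) (distribˡ _ _ _)) (×-distrib-+ _ _ (oddFactorial k))

      coeff-0 : ∀ k → coeff k 0# ≈ 0#
      coeff-0 k = trans (×-congʳ (oddFactorial k) (*-comm _ _))
        (trans (sym (×-comm-* (oddFactorial k) 0# (b ^ k))) (zeroˡ _))

      coeff-*ˡ : ∀ k x y → x * coeff k y ≈ coeff k (x * y)
      coeff-*ˡ k x y = trans (×-comm-* (oddFactorial k) _ _)
        (×-congʳ (oddFactorial k) (trans (sym (*-assoc _ _ _)) (trans (*-congʳ (*-comm _ _)) (*-assoc _ _ _))))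

      coeff-suc : ∀ k x → coeff (suc k) x ≈ b * coeff k (suc (2 ℕ.* k) · x)
      coeff-suc k x = begin
        (suc (2 ℕ.* k) ℕ.* oddFactorial k) · (b * b ^ k * x)
          ≈⟨ ×-congʳ (suc (2 ℕ.* k) ℕ.* oddFactorial k) (*-assoc _ _ _) ⟩
        (suc (2 ℕ.* k) ℕ.* oddFactorial k) · (b * (b ^ k * x))
          ≈⟨ ×-congˡ (ℕ.*-comm (suc (2 ℕ.* k)) (oddFactorial k)) ⟩
        (oddFactorial k ℕ.* suc (2 ℕ.* k)) · (b * (b ^ k * x))
          ≈⟨ ×-assocˡ _ (oddFactorial k) (suc (2 ℕ.* k)) ⟨
        oddFactorial k · (suc (2 ℕ.* k) · (b * (b ^ k * x)))
          ≈⟨ ×-congʳ (oddFactorial k) (trans (sym (×-comm-* (suc (2 ℕ.* k)) _ _))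
               (*-congˡ (sym (×-comm-* (suc (2 ℕ.* k)) _ _)))) ⟩
        oddFactorial k · (b * (b ^ k * (suc (2 ℕ.* k) · x)))
          ≈⟨ ×-comm-* (oddFactorial k) _ _ ⟨
        b * coeff k (suc (2 ℕ.* k) · x) ∎

      pickSum-coeff : ∀ k f vs → pickSum (λ u us → coeff k (f u us)) vs ≈ coeff k (pickSum f vs)
      pickSum-coeff k f vs =
        trans (pickSum-· (oddFactorial k) _ vs) (×-congʳ (oddFactorial k) (pickSum-*ˡ _ f vs))

      -- The part of `matchSum w′ j (v ∷ vs)` in which v is covered; at j = 0 there is none.
      ext : ℕ → V → List V → Carrier
      ext zero    v vs = 0#
      ext (suc j) v vs = pickSum (λ u us → w′ v u * matchSum w′ j us) vs

      matchSum-∷ : ∀ j v vs → matchSum w′ j (v ∷ vs) ≈ matchSum w′ j vs + ext j v vs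
      matchSum-∷ zero    v vs = sym (+-identityʳ 1#)
      matchSum-∷ (suc j) v vs = refl

    -- Choosing the edges weighted by w′ first leaves 2k vertices, which can be paired off by
    -- edges of weight b in oddFactorial k ways.
    matchSum-perfect : ∀ m vs → length vs ≡ 2 ℕ.* m →
      matchSum w m vs ≈ anti (λ k j → oddFactorial k · (b ^ k * matchSum w′ j vs)) m
    matchSum-perfect zero    vs       p = sym (trans (+-identityʳ _) (*-identityʳ _))
    matchSum-perfect (suc m) (v ∷ vs) p = begin
      matchSum w (suc m) vs + pickSum (λ u us → w v u * matchSum w m us) vs
        -- A perfect matching covers v, since the 2m + 1 vertices of `vs` cannot carry m + 1 edges.
        ≈⟨ trans (+-congʳ (matchSum-short w (suc m) vs (ℕ.≤-reflexive p))) (+-identityˡ _) ⟩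
      pickSum (λ u us → w v u * matchSum w m us) vs
        ≈⟨ pickSum-cong vs (λ u us q → trans (*-cong (w≈b+w′ v u) (matchSum-perfect m us (shorter us q)))
             (distribʳ _ _ _)) ⟩
      pickSum (λ u us → b * T us + w′ v u * T us) vs
        ≈⟨ pickSum-+ _ _ vs ⟩
      pickSum (λ u us → b * T us) vs + pickSum (λ u us → w′ v u * T us) vs
        ≈⟨ +-cong free forced ⟩
      anti (λ k j → coeff k (matchSum w′ j vs)) (suc m) + anti (λ k j → coeff k (ext j v vs)) (suc m)
        ≈⟨ anti-+ (λ k j → coeff k (matchSum w′ j vs)) (λ k j → coeff k (ext j v vs)) (suc m) ⟨
      anti (λ k j → coeff k (matchSum w′ j vs) + coeff k (ext j v vs)) (suc m)
        ≈⟨ anti-cong (suc m) (λ k j _ → trans (coeff-cong k (matchSum-∷ j v vs)) (coeff-+ k _ _)) ⟨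
      anti (λ k j → coeff k (matchSum w′ j (v ∷ vs))) (suc m) ∎
      where
      T : List V → Carrier
      T us = anti (λ k j → coeff k (matchSum w′ j us)) m

      shorter : ∀ us → suc (length us) ≡ length vs → length us ≡ 2 ℕ.* m
      shorter us q = ℕ.suc-injective (ℕ.suc-injective
        (≡.trans (≡.cong suc q) (≡.trans p (ℕ.*-suc 2 m))))

      count : ∀ k j → k ℕ.+ j ≡ m → length vs ≡ 2 ℕ.* j ℕ.+ suc (2 ℕ.* k)
      count k j ≡.refl = ℕ.suc-injective (≡.trans p
        (solve 2 (λ k j → con 2 :* (con 1 :+ (k :+ j)) := con 1 :+ (con 2 :* j :+ (con 1 :+ con 2 :* k)))
               ≡.refl k j))
        where open +-*-Solver

      -- The edge at v has weight b. Its other end is any of the 2k + 1 vertices of `vs` missed by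
      -- the j edges of weight `w′`; this is the factor that takes (2k - 1)!! to (2k + 1)!!.
      free : pickSum (λ u us → b * T us) vs ≈ anti (λ k j → coeff k (matchSum w′ j vs)) (suc m)
      free = begin
        pickSum (λ u us → b * T us) vs
          ≈⟨ trans (pickSum-*ˡ b _ vs) (*-congˡ (pickSum-anti _ m vs)) ⟩
        b * anti (λ k j → pickSum (λ _ us → coeff k (matchSum w′ j us)) vs) m
          ≈⟨ anti-*ˡ b _ m ⟨
        anti (λ k j → b * pickSum (λ _ us → coeff k (matchSum w′ j us)) vs) m
          ≈⟨ anti-cong m (λ k j q → trans
               (*-congˡ (trans (pickSum-coeff k _ vs)
                 (coeff-cong k (pickSum-matchSum w′ j (suc (2 ℕ.* k)) vs (count k j q)))))
               (sym (coeff-suc k _))) ⟩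
        anti (λ k j → coeff (suc k) (matchSum w′ j vs)) m
          ≈⟨ +-identityˡ _ ⟨
        0# + anti (λ k j → coeff (suc k) (matchSum w′ j vs)) m
          -- The added term k = 0 asks for m + 1 edges on the 2m + 1 vertices of `vs`.
          ≈⟨ +-congʳ (trans (coeff-cong 0 (matchSum-short w′ (suc m) vs (ℕ.≤-reflexive p))) (coeff-0 0)) ⟨
        anti (λ k j → coeff k (matchSum w′ j vs)) (suc m) ∎

      -- The edge at v is weighted by `w′`, so j grows and k stays; the term with j = 0 is missing,
      -- and `ext` is zero there.
      forced : pickSum (λ u us → w′ v u * T us) vs ≈ anti (λ k j → coeff k (ext j v vs)) (suc m)
      forced = begin
        pickSum (λ u us → w′ v u * T us) vs
          ≈⟨ pickSum-cong vs (λ u us _ → trans (sym (anti-*ˡ _ _ m)) (anti-cong m λ k j _ → coeff-*ˡ k _ _)) ⟩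
        pickSum (λ u us → anti (λ k j → coeff k (w′ v u * matchSum w′ j us)) m) vs
          ≈⟨ trans (pickSum-anti _ m vs) (anti-cong m λ k j _ → pickSum-coeff k _ vs) ⟩
        anti (λ k j → coeff k (ext (suc j) v vs)) m
          ≈⟨ anti-zeroʳ (λ k j → coeff k (ext j v vs)) m coeff-0 ⟨
        anti (λ k j → coeff k (ext j v vs)) (suc m) ∎

-- From lists of edges to lists of vertices

open Equivalence using (to; from)

module _ {a} {A : Set a} where

  filter-cong : ∀ {p q} {P : A → Set p} {Q : A → Set q} (P? : Decidable P) (Q? : Decidable Q) {xs} →
                All (λ x → P x ⇔ Q x) xs → filter P? xs ≡ filter Q? xs
  filter-cong P? Q? []                = ≡.refl
  filter-cong P? Q? {x ∷ xs} (e ∷ es) with P? x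
  ... | yes p = ≡.trans (≡.cong (x ∷_) (filter-cong P? Q? es)) (≡.sym (filter-accept Q? (to e p)))
  ... | no ¬p = ≡.trans (filter-cong P? Q? es) (≡.sym (filter-reject Q? (¬p ∘ from e)))

  filter-filter : ∀ {p q r} {P : A → Set p} {Q : A → Set q} {R : A → Set r}
                  (P? : Decidable P) (Q? : Decidable Q) (R? : Decidable R) →
                  (∀ x → R x ⇔ (Q x × P x)) → ∀ xs → filter P? (filter Q? xs) ≡ filter R? xs
  filter-filter P? Q? R? R⇔Q×P []       = ≡.refl
  filter-filter P? Q? R? R⇔Q×P (x ∷ xs) with Q? x
  ... | no ¬q = ≡.trans (filter-filter P? Q? R? R⇔Q×P xs)
                  (≡.sym (filter-reject R? (¬q ∘ proj₁ ∘ to (R⇔Q×P x))))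
  ... | yes q with P? x
  ...   | no ¬p = ≡.trans (filter-filter P? Q? R? R⇔Q×P xs)
                    (≡.sym (filter-reject R? (¬p ∘ proj₂ ∘ to (R⇔Q×P x))))
  ...   | yes p = ≡.trans (≡.cong (x ∷_) (filter-filter P? Q? R? R⇔Q×P xs))
                    (≡.sym (filter-accept R? (from (R⇔Q×P x) (q , p))))

  filter-map : ∀ {b p} {B : Set b} {P : A → Set p} (P? : Decidable P) (f : B → A) xs →
               filter P? (map f xs) ≡ map f (filter (P? ∘ f) xs)
  filter-map P? f []       = ≡.refl
  filter-map P? f (x ∷ xs) with P? (f x)
  ... | yes _ = ≡.cong (f x ∷_) (filter-map P? f xs)
  ... | no  _ = filter-map P? f xs

module _ {a} {A : Set a} where

  all-sublists : ∀ {p} {P : A → Set p} {xs} → All P xs → All (All P) (sublists xs)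
  all-sublists []         = [] ∷ []
  all-sublists (px ∷ pxs) =
    All.++⁺ (All.map⁺ (All.map (px ∷_) (all-sublists pxs))) (all-sublists pxs)

  -- Used both for the edges disjoint from a chosen edge and for the edges of a graph among all
  -- pairs.
  filter-all-sublists : ∀ {p} {P : A → Set p} (P? : Decidable P) xs →
                        filter (All.all? P?) (sublists xs) ≡ sublists (filter P? xs)
  filter-all-sublists P? []       = ≡.refl
  filter-all-sublists {P = P} P? (x ∷ xs) =
    ≡.trans (filter-++ all? (map (x ∷_) (sublists xs)) (sublists xs)) split
    where
    all? = All.all? P?
    split : filter all? (map (x ∷_) (sublists xs)) ++ filter all? (sublists xs) ≡
            sublists (filter P? (x ∷ xs))
    split with P? x
    ... | yes px = ≡.cong₂ _++_
      (≡.trans (filter-map all? (x ∷_) (sublists xs))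
        (≡.cong (map (x ∷_)) (≡.trans
          (filter-cong (all? ∘ (x ∷_)) all? (All.universal (λ _ → mk⇔ All.tail (px ∷_)) (sublists xs)))
          (filter-all-sublists P? xs))))
      (filter-all-sublists P? xs)
    ... | no ¬px = ≡.cong₂ _++_
      (filter-none all? (All.map⁺ (All.universal (λ _ → ¬px ∘ All.head) (sublists xs))))
      (filter-all-sublists P? xs)

  -- Grouped by the earlier vertex: the star at v, then the pairs avoiding v. This grouping is what
  -- allows v to be removed.
  pairs : List A → List (A × A)
  pairs []       = []
  pairs (v ∷ vs) = map (v ,_) vs ++ pairs vs

  filter-pairs : ∀ {p q} {P : A → Set p} {Q : A × A → Set q} (P? : Decidable P) (Q? : Decidable Q) →
                 (∀ i j → Q (i , j) ⇔ (P i × P j)) →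
                 ∀ vs → filter Q? (pairs vs) ≡ pairs (filter P? vs)
  filter-pairs P? Q? Q⇔P×P []       = ≡.refl
  filter-pairs P? Q? Q⇔P×P (v ∷ vs) =
    ≡.trans (filter-++ Q? (map (v ,_) vs) (pairs vs)) split
    where
    split : filter Q? (map (v ,_) vs) ++ filter Q? (pairs vs) ≡ pairs (filter P? (v ∷ vs))
    split with P? v
    ... | yes pv = ≡.cong₂ _++_
      (≡.trans (filter-map Q? (v ,_) vs) (≡.cong (map (v ,_))
        (filter-cong _ P? (All.universal (λ u → mk⇔ (proj₂ ∘ to (Q⇔P×P v u)) (λ pu → from (Q⇔P×P v u) (pv , pu))) vs))))
      (filter-pairs P? Q? Q⇔P×P vs)
    ... | no ¬pv = ≡.cong₂ _++_
      (filter-none Q? (All.map⁺ (All.universal (λ u → ¬pv ∘ proj₁ ∘ to (Q⇔P×P v u)) vs)))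
      (filter-pairs P? Q? Q⇔P×P vs)

module _ {n : ℕ} where

  private
    <? : Decidable (λ (e : Pair n) → proj₁ e Fin.< proj₂ e)
    <? e = proj₁ e Fin.<? proj₂ e

    filter-below : ∀ {v : Fin n} {us} ws → All (v Fin.<_) us →
                   filter <? (cartesianProduct us (v ∷ ws)) ≡ filter <? (cartesianProduct us ws)
    filter-below ws []                   = ≡.refl
    filter-below {v} {u ∷ us} ws (v<u ∷ v<us) = begin
      filter <? (map (u ,_) (v ∷ ws) ++ cartesianProduct us (v ∷ ws))
        ≡⟨ filter-reject <? {u , v} (ℕ.<-asym v<u) ⟩
      filter <? (map (u ,_) ws ++ cartesianProduct us (v ∷ ws))
        ≡⟨ filter-++ <? (map (u ,_) ws) _ ⟩
      filter <? (map (u ,_) ws) ++ filter <? (cartesianProduct us (v ∷ ws))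
        ≡⟨ ≡.cong (filter <? (map (u ,_) ws) ++_) (filter-below ws v<us) ⟩
      filter <? (map (u ,_) ws) ++ filter <? (cartesianProduct us ws)
        ≡⟨ filter-++ <? (map (u ,_) ws) _ ⟨
      filter <? (map (u ,_) ws ++ cartesianProduct us ws) ∎
      where open ≡.≡-Reasoning

    filter-all-map : ∀ {v : Fin n} {ws} → All (v Fin.<_) ws → filter <? (map (v ,_) ws) ≡ map (v ,_) ws
    filter-all-map []           = ≡.refl
    filter-all-map {v} {w ∷ ws} (v<w ∷ v<ws) =
      ≡.trans (filter-accept <? v<w) (≡.cong ((v , w) ∷_) (filter-all-map v<ws))

    -- In an increasing list, comparing entries is comparing positions, so the filter keeps exactly
    -- the part of the product above the diagonal.
    filter-sorted : ∀ {vs : List (Fin n)} → AllPairs Fin._<_ vs → filter <? (cartesianProduct vs vs) ≡ pairs vs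
    filter-sorted []                       = ≡.refl
    filter-sorted {v ∷ vs} (v<vs ∷ sorted) = begin
      filter <? (map (v ,_) (v ∷ vs) ++ cartesianProduct vs (v ∷ vs))
        ≡⟨ filter-reject <? {v , v} (ℕ.<-irrefl ≡.refl) ⟩
      filter <? (map (v ,_) vs ++ cartesianProduct vs (v ∷ vs))
        ≡⟨ filter-++ <? (map (v ,_) vs) _ ⟩
      filter <? (map (v ,_) vs) ++ filter <? (cartesianProduct vs (v ∷ vs))
        ≡⟨ ≡.cong₂ _++_ (filter-all-map v<vs) (≡.trans (filter-below vs v<vs) (filter-sorted sorted)) ⟩
      pairs (v ∷ vs) ∎
      where open ≡.≡-Reasoning

  unorderedPairs≡pairs : unorderedPairs n ≡ pairs (allFin n)
  unorderedPairs≡pairs = filter-sorted (AllPairs.tabulate⁺-< (λ i<j → i<j))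

  IsMatching : ℕ → List (Pair n) → Set
  IsMatching k es = length es ≡ k × AllPairs Disjoint es

  isMatching? : ∀ k → Decidable (IsMatching k)
  isMatching? k es = (length es ℕ.≟ k) ×-dec allPairs? disjoint? es

  matchings : ℕ → List (Pair n) → List (List (Pair n))
  matchings k E = filter (isMatching? k) (sublists E)

  matchings-0 : ∀ E → matchings 0 E ≡ [] ∷ []
  matchings-0 []      = ≡.refl
  matchings-0 (e ∷ E) = ≡.trans (filter-++ (isMatching? 0) (map (e ∷_) (sublists E)) (sublists E))
    (≡.cong₂ _++_ (filter-none (isMatching? 0) (All.map⁺ (All.universal (λ _ ()) (sublists E))))
      (matchings-0 E))

  -- Sublists containing e are listed first, and the rest of such a matching consists of edges
  -- disjoint from e.
  matchings-suc : ∀ k e E → matchings (suc k) (e ∷ E) ≡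
                  map (e ∷_) (matchings k (filter (disjoint? e) E)) ++ matchings (suc k) E
  matchings-suc k e E = ≡.trans (filter-++ (isMatching? (suc k)) (map (e ∷_) (sublists E)) (sublists E))
    (≡.cong (_++ matchings (suc k) E) (≡.trans (filter-map (isMatching? (suc k)) (e ∷_) (sublists E))
      (≡.cong (map (e ∷_)) (≡.trans
        (≡.sym (filter-filter (isMatching? k) (All.all? (disjoint? e)) (isMatching? (suc k) ∘ (e ∷_))
          (λ _ → mk⇔ (λ { (p , d ∷ ds) → d , ℕ.suc-injective p , ds })
                     (λ { (d , p , ds) → ≡.cong suc p , d ∷ ds }))
          (sublists E)))
        (≡.cong (filter (isMatching? k)) (filter-all-sublists (disjoint? e) E))))))

  infixl 6 _∖_

  _∖_ : List (Fin n) → Fin n → List (Fin n)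
  vs ∖ u = filter (λ t → ¬? (u Fin.≟ t)) vs

  disjoint-pairs : ∀ {v u : Fin n} {vs} → All (v ≢_) vs →
    filter (disjoint? (v , u)) (pairs vs) ≡ pairs (vs ∖ u)
  disjoint-pairs {v} {u} {vs} v∉vs = ≡.trans
    (filter-pairs both? (disjoint? (v , u))
      (λ i j → mk⇔ (λ ((a , b) , (c , d)) → (a , c) , (b , d)) (λ ((a , c) , (b , d)) → (a , b) , (c , d))) vs)
    (≡.cong pairs (filter-cong both? _ (All.map (λ v≢t → mk⇔ proj₂ (v≢t ,_)) v∉vs)))
    where
    both? : Decidable (λ t → v ≢ t × u ≢ t)
    both? t = ¬? (v Fin.≟ t) ×-dec ¬? (u Fin.≟ t)

  endpoints : List (Pair n) → List (Fin n)
  endpoints []             = []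
  endpoints ((i , j) ∷ ps) = i ∷ j ∷ endpoints ps

  length-endpoints : ∀ ps → length (endpoints ps) ≡ 2 ℕ.* length ps
  length-endpoints []       = ≡.refl
  length-endpoints (p ∷ ps) =
    ≡.trans (≡.cong (2 ℕ.+_) (length-endpoints ps)) (≡.sym (ℕ.*-suc 2 (length ps)))

  ∈-endpoints⁺ : ∀ {v ps} → Any (v ∈ₚ_) ps → v ∈ endpoints ps
  ∈-endpoints⁺ (here (inj₁ p)) = here p
  ∈-endpoints⁺ (here (inj₂ p)) = there (here p)
  ∈-endpoints⁺ (there q)       = there (there (∈-endpoints⁺ q))

  ∈-endpoints⁻ : ∀ {v} ps → v ∈ endpoints ps → Any (v ∈ₚ_) ps
  ∈-endpoints⁻ (_ ∷ _)  (here p)          = here (inj₁ p)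
  ∈-endpoints⁻ (_ ∷ _)  (there (here p))  = here (inj₂ p)
  ∈-endpoints⁻ (_ ∷ ps) (there (there q)) = there (∈-endpoints⁻ ps q)

  endpoints-≢ˡ : ∀ {i j ps} → All (Disjoint (i , j)) ps → All (i ≢_) (endpoints ps)
  endpoints-≢ˡ []                         = []
  endpoints-≢ˡ (((a , b) , _) ∷ ds) = a ∷ b ∷ endpoints-≢ˡ ds

  endpoints-≢ʳ : ∀ {i j ps} → All (Disjoint (i , j)) ps → All (j ≢_) (endpoints ps)
  endpoints-≢ʳ []                         = []
  endpoints-≢ʳ ((_ , (a , b)) ∷ ds) = a ∷ b ∷ endpoints-≢ʳ ds

  endpoints-unique : ∀ {ps} → All (uncurry _≢_) ps → AllPairs Disjoint ps → Unique (endpoints ps)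
  endpoints-unique []          []       = []
  endpoints-unique (i≢j ∷ ≢s) (d ∷ ds) =
    (i≢j ∷ endpoints-≢ˡ d) ∷ endpoints-≢ʳ d ∷ endpoints-unique ≢s ds

  lookup-injective : ∀ {xs : List (Fin n)} → Unique xs → Injective _≡_ _≡_ (lookup xs)
  lookup-injective (x∉xs ∷ u) {zero}  {zero}  eq = ≡.refl
  lookup-injective (x∉xs ∷ u) {zero}  {suc j} eq = contradiction eq (All.lookup x∉xs (∈-lookup j))
  lookup-injective (x∉xs ∷ u) {suc i} {zero}  eq = contradiction (≡.sym eq) (All.lookup x∉xs (∈-lookup i))
  lookup-injective (x∉xs ∷ u) {suc i} {suc j} eq = ≡.cong suc (lookup-injective u eq)

  unique⇒length≤ : ∀ {xs : List (Fin n)} → Unique xs → length xs ≤ n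
  unique⇒length≤ u = Fin.injective⇒≤ (lookup-injective u)

  complete⇒length≥ : ∀ {xs : List (Fin n)} → (∀ v → v ∈ xs) → n ≤ length xs
  complete⇒length≥ {xs} c = Fin.injective⇒≤ {f = λ v → Any.index (c v)} λ {u} {v} eq →
    ≡.trans (lookup-index (c u)) (≡.trans (≡.cong (lookup xs) eq) (≡.sym (lookup-index (c v))))

  unique-full⇒complete : ∀ {xs : List (Fin n)} → Unique xs → length xs ≡ n → ∀ v → v ∈ xs
  unique-full⇒complete {xs} u eq v with Any.any? (v Fin.≟_) xs
  ... | yes v∈xs = v∈xs
  ... | no  v∉xs = contradiction
    (≡.subst (λ l → suc l ≤ n) eq (unique⇒length≤ (All.¬Any⇒All¬ xs v∉xs ∷ u))) ℕ.1+n≰n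

-- Disjoint pairs of distinct vertices have distinct endpoints, twice as many as pairs. By the
-- pigeonhole principle such endpoints exhaust the 2m vertices exactly when there are m pairs.
isPartition⇔isMatching : ∀ m {ps : List (Pair (2 ℕ.* m))} → All (uncurry _≢_) ps →
                         IsPartition ps ⇔ IsMatching m ps
isPartition⇔isMatching m {ps} ≢s = mk⇔
  (λ (ds , cover) → ℕ.*-cancelˡ-≡ (length ps) m 2 (≡.trans (≡.sym (length-endpoints ps))
      (ℕ.≤-antisym (unique⇒length≤ (endpoints-unique ≢s ds))
                   (complete⇒length≥ (λ v → ∈-endpoints⁺ (cover v))))) , ds)
  (λ (len , ds) → ds , λ v → ∈-endpoints⁻ ps (unique-full⇒complete (endpoints-unique ≢s ds)
      (≡.trans (length-endpoints ps) (≡.cong (2 ℕ.*_) len)) v))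

unorderedPairs-< : ∀ n → All (uncurry Fin._<_) (unorderedPairs n)
unorderedPairs-< n = All.all-filter (λ e → proj₁ e Fin.<? proj₂ e) (cartesianProduct (allFin n) (allFin n))

pairPartitions≡matchings : ∀ m → pairPartitions (2 ℕ.* m) ≡ matchings m (unorderedPairs (2 ℕ.* m))
pairPartitions≡matchings m = filter-cong isPartition? (isMatching? m)
  (All.map (λ <s → isPartition⇔isMatching m (All.map Fin.<⇒≢ <s))
    (all-sublists (unorderedPairs-< (2 ℕ.* m))))

-- Weighted sums of matchings over a list of edges

module EdgeSums {c ℓ} (S : CommutativeSemiring c ℓ) where
  open CommutativeSemiring S hiding (zero)
  open SetoidReasoning setoid

  listSum : ∀ {a} {A : Set a} → (A → Carrier) → List A → Carrier
  listSum f xs = foldr _+_ 0# (map f xs)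

  listSum-cong : ∀ {a} {A : Set a} {f g : A → Carrier} {xs} → All (λ x → f x ≈ g x) xs →
                 listSum f xs ≈ listSum g xs
  listSum-cong []       = refl
  listSum-cong (e ∷ es) = +-cong e (listSum-cong es)

  listSum-++ : ∀ {a} {A : Set a} (f : A → Carrier) xs ys → listSum f (xs ++ ys) ≈ listSum f xs + listSum f ys
  listSum-++ f []       ys = sym (+-identityˡ _)
  listSum-++ f (x ∷ xs) ys = trans (+-congˡ (listSum-++ f xs ys)) (sym (+-assoc _ _ _))

  listSum-map : ∀ {a b} {A : Set a} {B : Set b} (f : B → Carrier) (g : A → B) xs →
                listSum f (map g xs) ≡ listSum (λ x → f (g x)) xs
  listSum-map f g xs = ≡.cong (foldr _+_ 0#) (≡.sym (map-∘ xs))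

  listSum-*ˡ : ∀ {a} {A : Set a} x (f : A → Carrier) xs → listSum (λ y → x * f y) xs ≈ x * listSum f xs
  listSum-*ˡ x f []       = sym (zeroʳ x)
  listSum-*ˡ x f (y ∷ ys) = trans (+-congˡ (listSum-*ˡ x f ys)) (sym (distribˡ _ _ _))

  module _ {n : ℕ} where
    open Matchings S {V = Fin n}

    weight : Weight → List (Pair n) → Carrier
    weight w ps = foldr _*_ 1# (map (uncurry w) ps)

    weight-cong : ∀ {w w′ : Weight} {ps} → All (λ e → uncurry w e ≈ uncurry w′ e) ps → weight w ps ≈ weight w′ ps
    weight-cong []       = refl
    weight-cong (e ∷ es) = *-cong e (weight-cong es)

    edgeSum : Weight → ℕ → List (Pair n) → Carrier
    edgeSum w k E = listSum (weight w) (matchings k E)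

    edgeSum-0 : ∀ w E → edgeSum w 0 E ≈ 1#
    edgeSum-0 w E = trans (reflexive (≡.cong (listSum (weight w)) (matchings-0 E))) (+-identityʳ 1#)

    edgeSum-suc : ∀ w k e E →
      edgeSum w (suc k) (e ∷ E) ≈ uncurry w e * edgeSum w k (filter (disjoint? e) E) + edgeSum w (suc k) E
    edgeSum-suc w k e E = begin
      edgeSum w (suc k) (e ∷ E)
        ≡⟨ ≡.cong (listSum (weight w)) (matchings-suc k e E) ⟩
      listSum (weight w) (map (e ∷_) rest ++ matchings (suc k) E)
        ≈⟨ listSum-++ (weight w) (map (e ∷_) rest) (matchings (suc k) E) ⟩
      listSum (weight w) (map (e ∷_) rest) + edgeSum w (suc k) E
        ≈⟨ +-congʳ (trans (reflexive (listSum-map (weight w) (e ∷_) rest))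
             (listSum-*ˡ (uncurry w e) (weight w) rest)) ⟩
      uncurry w e * edgeSum w k (filter (disjoint? e) E) + edgeSum w (suc k) E ∎
      where rest = matchings k (filter (disjoint? e) E)

    -- The edges at v are peeled off one at a time. Once one is chosen, the later ones share v with
    -- it and are filtered out, so only `E` is left to choose from.
    edgeSum-star : ∀ w k v us E → edgeSum w (suc k) (map (v ,_) us ++ E) ≈
      listSum (λ u → w v u * edgeSum w k (filter (disjoint? (v , u)) E)) us + edgeSum w (suc k) E
    edgeSum-star w k v []       E = sym (+-identityˡ _)
    edgeSum-star w k v (u ∷ us) E = begin
      edgeSum w (suc k) ((v , u) ∷ (map (v ,_) us ++ E))
        ≈⟨ edgeSum-suc w k (v , u) (map (v ,_) us ++ E) ⟩
      w v u * edgeSum w k (filter d? (map (v ,_) us ++ E)) + edgeSum w (suc k) (map (v ,_) us ++ E)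
        ≈⟨ +-cong (*-congˡ (reflexive (≡.cong (edgeSum w k) drop-star))) (edgeSum-star w k v us E) ⟩
      w v u * edgeSum w k (filter d? E) + (listSum _ us + edgeSum w (suc k) E)
        ≈⟨ +-assoc _ _ _ ⟨
      listSum (λ u → w v u * edgeSum w k (filter (disjoint? (v , u)) E)) (u ∷ us) + edgeSum w (suc k) E ∎
      where
      d? = disjoint? (v , u)
      drop-star : filter d? (map (v ,_) us ++ E) ≡ filter d? E
      drop-star = ≡.trans (filter-++ d? (map (v ,_) us) E) (≡.cong (_++ filter d? E)
        (filter-none d? (All.map⁺ (All.universal (λ _ d → proj₁ (proj₁ d) ≡.refl) us))))

    -- Without repetitions, removing the value u is removing its position; this links removal by
    -- filtering on edges to `pickSum`.
    pickSum-unique : ∀ f {vs} → Unique vs →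
      pickSum f vs ≈ listSum (λ u → f u (vs ∖ u)) vs
    pickSum-unique f []                    = refl
    pickSum-unique f {v ∷ vs} (v∉vs ∷ uniq) = +-cong
      (reflexive (≡.cong (f v) (≡.sym (≡.trans
        (filter-reject (λ t → ¬? (v Fin.≟ t)) (λ v≢v → v≢v ≡.refl))
        (filter-all (λ t → ¬? (v Fin.≟ t)) v∉vs)))))
      (trans (pickSum-unique (λ t ts → f t (v ∷ ts)) uniq)
        (listSum-cong (All.map (λ {t} v≢t → reflexive (≡.cong (f t)
          (≡.sym (filter-accept (λ u → ¬? (t Fin.≟ u)) (v≢t ∘ ≡.sym))))) v∉vs)))

    edgeSum-pairs : ∀ w k {vs} → Unique vs → edgeSum w k (pairs vs) ≈ matchSum w k vs
    edgeSum-pairs w zero    {vs} _ = edgeSum-0 w (pairs vs)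
    edgeSum-pairs w (suc k) {[]} _ = refl
    edgeSum-pairs w (suc k) {v ∷ vs} (v∉vs ∷ uniq) = begin
      edgeSum w (suc k) (map (v ,_) vs ++ pairs vs)
        ≈⟨ edgeSum-star w k v vs (pairs vs) ⟩
      listSum (λ u → w v u * edgeSum w k (filter (disjoint? (v , u)) (pairs vs))) vs + edgeSum w (suc k) (pairs vs)
        ≈⟨ +-cong (listSum-cong (All.universal remove vs)) (edgeSum-pairs w (suc k) uniq) ⟩
      listSum (λ u → w v u * matchSum w k (vs ∖ u)) vs + matchSum w (suc k) vs
        ≈⟨ +-congʳ (pickSum-unique (λ u us → w v u * matchSum w k us) uniq) ⟨
      pickSum (λ u us → w v u * matchSum w k us) vs + matchSum w (suc k) vs
        ≈⟨ +-comm _ _ ⟩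
      matchSum w (suc k) (v ∷ vs) ∎
      where
      remove : ∀ u → w v u * edgeSum w k (filter (disjoint? (v , u)) (pairs vs)) ≈ w v u * matchSum w k (vs ∖ u)
      -- The recursion descends in k here, as the filtered list is not a subterm of `vs`.
      remove u = *-congˡ (trans (reflexive (≡.cong (edgeSum w k) (disjoint-pairs v∉vs)))
        (edgeSum-pairs w k (Unique.filter⁺ (λ t → ¬? (u Fin.≟ t)) uniq)))

    edgeSum≈matchSum : ∀ w k → edgeSum w k (unorderedPairs n) ≈ matchSum w k (allFin n)
    edgeSum≈matchSum w k = trans (reflexive (≡.cong (edgeSum w k) unorderedPairs≡pairs))
      (edgeSum-pairs w k (Unique.allFin⁺ n))

-- The square of a path

private
  module ℕ-anti = Antidiagonal ℕ.+-*-commutativeSemiring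
  module +-Semigroup = CommutativeSemigroup ℕ.+-commutativeSemigroup

open ℕ-anti using () renaming (anti to antiℕ)
open Sum ℕ.+-0-monoid using (sum; sum-cong-≗)

-- The matchings of the square of a path correspond to the tilings of the path by four kinds of
-- tiles: a vertex, an edge {x , x+1}, an edge {x , x+2} with x+1 uncovered, and the two crossing
-- edges {x , x+2}, {x+1 , x+3}.  Of N tiles, q are not single vertices, i of these are of the
-- last two kinds, and p of the last kind.
tilings : ℕ → ℕ → ℕ → ℕ → ℕ
tilings N q i p = (N C q) ℕ.* (q C i) ℕ.* (i C p)

tilingsBy : ℕ → ℕ → ℕ → ℕ
tilingsBy N i j = antiℕ (λ p q → tilings N q i p) j

-- The tilings of s + j vertices with j edges have s = N + i.
allTilings : ℕ → ℕ → ℕ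
allTilings s j = antiℕ (λ i N → tilingsBy N i j) s

-- The tilings of tilingsBy (suc N) i (suc j) whose first tile has one of the last two kinds.
longTilings : ℕ → ℕ → ℕ → ℕ
longTilings N zero    j       = 0
longTilings N (suc i) zero    = tilingsBy N i 0
longTilings N (suc i) (suc j) = tilingsBy N i (suc j) ℕ.+ tilingsBy N i j

-- Pascal's rule on the first binomial: the first summand has a single vertex as first tile, the
-- second a larger tile.
tilings-suc-suc : ∀ N q i p →
  tilings (suc N) (suc q) i p ≡ tilings N (suc q) i p ℕ.+ (N C q) ℕ.* (suc q C i) ℕ.* (i C p)
tilings-suc-suc N q i p = begin
  (suc N C suc q) ℕ.* x ℕ.* y             ≡⟨ ≡.cong (λ t → t ℕ.* x ℕ.* y) (nCk+nC[k+1]≡[n+1]C[k+1] N q) ⟨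
  (N C q ℕ.+ N C suc q) ℕ.* x ℕ.* y       ≡⟨ regroup (N C q) (N C suc q) x y ⟩
  (N C suc q) ℕ.* x ℕ.* y ℕ.+ (N C q) ℕ.* x ℕ.* y ∎
  where
  open ≡.≡-Reasoning
  x = suc q C i
  y = i C p
  regroup : ∀ a b x y → (a ℕ.+ b) ℕ.* x ℕ.* y ≡ b ℕ.* x ℕ.* y ℕ.+ a ℕ.* x ℕ.* y
  regroup = solve 4 (λ a b x y → (a :+ b) :* x :* y := b :* x :* y :+ a :* x :* y) ≡.refl
    where open +-*-Solver

-- The first tile is of one of the last two kinds. Pascal's rule on the third binomial decides
-- which: a lone edge leaves `suc j` edges to place, a crossing pair leaves one fewer.
antiℕ-long : ∀ N i j →
  antiℕ (λ p q → (N C q) ℕ.* (q C i) ℕ.* (suc i C p)) j ≡ longTilings N (suc i) j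
antiℕ-long N i zero    = ≡.refl
antiℕ-long N i (suc j) = begin
  tilings N (suc j) i 0 ℕ.+ antiℕ (λ p q → (N C q) ℕ.* (q C i) ℕ.* (suc i C suc p)) j
    ≡⟨ ≡.cong (tilings N (suc j) i 0 ℕ.+_) (ℕ-anti.anti-cong j λ p q _ → pascal p q) ⟩
  tilings N (suc j) i 0 ℕ.+ antiℕ (λ p q → tilings N q i (suc p) ℕ.+ tilings N q i p) j
    ≡⟨ ≡.cong (tilings N (suc j) i 0 ℕ.+_) (ℕ-anti.anti-+ _ _ j) ⟩
  tilings N (suc j) i 0 ℕ.+ (antiℕ (λ p q → tilings N q i (suc p)) j ℕ.+ tilingsBy N i j)
    ≡⟨ ℕ.+-assoc (tilings N (suc j) i 0) _ _ ⟨
  tilingsBy N i (suc j) ℕ.+ tilingsBy N i j ∎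
  where
  open ≡.≡-Reasoning
  pascal : ∀ p q → (N C q) ℕ.* (q C i) ℕ.* (suc i C suc p) ≡ tilings N q i (suc p) ℕ.+ tilings N q i p
  pascal p q = ≡.trans (≡.cong ((N C q) ℕ.* (q C i) ℕ.*_)
      (≡.trans (≡.sym (nCk+nC[k+1]≡[n+1]C[k+1] i p)) (ℕ.+-comm (i C p) (i C suc p))))
    (ℕ.*-distribˡ-+ ((N C q) ℕ.* (q C i)) _ _)

-- The first tile is not a single vertex. Pascal's rule on the second binomial separates an edge {x
-- , x+1} from the last two kinds.
antiℕ-nonSingle : ∀ N i j →
  antiℕ (λ p q → (N C q) ℕ.* (suc q C i) ℕ.* (i C p)) j ≡ tilingsBy N i j ℕ.+ longTilings N i j
antiℕ-nonSingle N zero    j = ≡.sym (ℕ.+-identityʳ _)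
antiℕ-nonSingle N (suc i) j = begin
  antiℕ (λ p q → (N C q) ℕ.* (suc q C suc i) ℕ.* (suc i C p)) j
    ≡⟨ ℕ-anti.anti-cong j (λ p q _ → pascal p q) ⟩
  antiℕ (λ p q → tilings N q (suc i) p ℕ.+ (N C q) ℕ.* (q C i) ℕ.* (suc i C p)) j
    ≡⟨ ℕ-anti.anti-+ _ _ j ⟩
  tilingsBy N (suc i) j ℕ.+ antiℕ (λ p q → (N C q) ℕ.* (q C i) ℕ.* (suc i C p)) j
    ≡⟨ ≡.cong (tilingsBy N (suc i) j ℕ.+_) (antiℕ-long N i j) ⟩
  tilingsBy N (suc i) j ℕ.+ longTilings N (suc i) j ∎
  where
  open ≡.≡-Reasoning
  pascal : ∀ p q → (N C q) ℕ.* (suc q C suc i) ℕ.* (suc i C p) ≡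
           tilings N q (suc i) p ℕ.+ (N C q) ℕ.* (q C i) ℕ.* (suc i C p)
  pascal p q = ≡.trans
    (≡.cong (λ t → (N C q) ℕ.* t ℕ.* (suc i C p)) (≡.sym (nCk+nC[k+1]≡[n+1]C[k+1] q i)))
    (solve 4 (λ n a b y → n :* (a :+ b) :* y := n :* b :* y :+ n :* a :* y) ≡.refl
      (N C q) (q C i) (q C suc i) (suc i C p))
    where open +-*-Solver

tilingsBy-suc : ∀ N i j → tilingsBy (suc N) i (suc j) ≡
                tilingsBy N i (suc j) ℕ.+ (tilingsBy N i j ℕ.+ longTilings N i j)
tilingsBy-suc N i j = begin
  tilingsBy (suc N) i (suc j)
    -- Pascal's rule does not apply to the term q = 0. That term is the same for `suc N` and N, so
    -- it is set aside and put back at the end.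
    ≡⟨ ℕ-anti.anti-snoc (λ p q → tilings (suc N) q i p) j ⟩
  antiℕ (λ p q → tilings (suc N) (suc q) i p) j ℕ.+ last
    ≡⟨ ≡.cong (ℕ._+ last) (≡.trans (ℕ-anti.anti-cong j λ p q _ → tilings-suc-suc N q i p)
         (ℕ-anti.anti-+ _ _ j)) ⟩
  antiℕ (λ p q → tilings N (suc q) i p) j ℕ.+ antiℕ (λ p q → (N C q) ℕ.* (suc q C i) ℕ.* (i C p)) j ℕ.+ last
    ≡⟨ +-Semigroup.xy∙z≈xz∙y (antiℕ (λ p q → tilings N (suc q) i p) j) _ last ⟩
  antiℕ (λ p q → tilings N (suc q) i p) j ℕ.+ last ℕ.+ antiℕ (λ p q → (N C q) ℕ.* (suc q C i) ℕ.* (i C p)) j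
    ≡⟨ ≡.cong₂ ℕ._+_ (≡.sym (ℕ-anti.anti-snoc (λ p q → tilings N q i p) j)) (antiℕ-nonSingle N i j) ⟩
  tilingsBy N i (suc j) ℕ.+ (tilingsBy N i j ℕ.+ longTilings N i j) ∎
  where
  open ≡.≡-Reasoning
  last = tilings N 0 i (suc j)

tilingsBy-0 : ∀ i j → tilingsBy 0 (suc i) j ≡ 0
tilingsBy-0 i j = ℕ-anti.anti-0 _ j λ { p zero → ≡.refl ; p (suc q) → ≡.refl }

-- The term dropped has N = 0 and i positive: with no tiles there is none of the last two kinds.
allTilings-snoc : ∀ s j → allTilings (suc s) j ≡ antiℕ (λ i N → tilingsBy (suc N) i j) s
allTilings-snoc s j = ≡.trans (ℕ-anti.anti-snoc (λ i N → tilingsBy N i j) s)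
  (≡.trans (≡.cong (antiℕ (λ i N → tilingsBy (suc N) i j) s ℕ.+_) (tilingsBy-0 s j)) (ℕ.+-identityʳ _))

allTilings-s-0 : ∀ s → allTilings s 0 ≡ 1
allTilings-s-0 zero    = ≡.refl
allTilings-s-0 (suc s) = ≡.trans (allTilings-snoc s 0) (allTilings-s-0 s)

allTilings-0-suc : ∀ j → allTilings 0 (suc j) ≡ 0
allTilings-0-suc j = ℕ-anti.anti-0 _ j λ p q → ℕ.*-zeroʳ ((0 C q) ℕ.* (q C 0))

allTilings-suc : ∀ s j → allTilings (suc s) (suc j) ≡
  allTilings s (suc j) ℕ.+ (allTilings s j ℕ.+ antiℕ (λ i N → longTilings N i j) s)
allTilings-suc s j = begin
  allTilings (suc s) (suc j)
    ≡⟨ allTilings-snoc s (suc j) ⟩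
  antiℕ (λ i N → tilingsBy (suc N) i (suc j)) s
    ≡⟨ ℕ-anti.anti-cong s (λ i N _ → tilingsBy-suc N i j) ⟩
  antiℕ (λ i N → tilingsBy N i (suc j) ℕ.+ (tilingsBy N i j ℕ.+ longTilings N i j)) s
    ≡⟨ ≡.trans (ℕ-anti.anti-+ _ _ s) (≡.cong (allTilings s (suc j) ℕ.+_) (ℕ-anti.anti-+ _ _ s)) ⟩
  allTilings s (suc j) ℕ.+ (allTilings s j ℕ.+ antiℕ (λ i N → longTilings N i j) s) ∎
  where open ≡.≡-Reasoning

allTilings-1-suc-suc : ∀ j → allTilings 1 (suc (suc j)) ≡ 0
allTilings-1-suc-suc j = ≡.trans (allTilings-suc 0 (suc j))
  (≡.cong₂ ℕ._+_ (allTilings-0-suc (suc j)) (≡.cong (ℕ._+ 0) (allTilings-0-suc j)))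

-- The four terms are the four kinds of first tile, which lower (s, j) by (1, 0), (1, 1), (2, 1) and
-- (2, 2). Since `longTilings` is zero at i = 0, its sum over the antidiagonal shifts down from
-- `suc s` to s.
allTilings-suc-suc : ∀ s j → allTilings (suc (suc s)) (suc (suc j)) ≡
  allTilings (suc s) (suc (suc j)) ℕ.+ (allTilings (suc s) (suc j) ℕ.+ (allTilings s (suc j) ℕ.+ allTilings s j))
allTilings-suc-suc s j = ≡.trans (allTilings-suc (suc s) (suc j))
  (≡.cong (λ t → allTilings (suc s) (suc (suc j)) ℕ.+ (allTilings (suc s) (suc j) ℕ.+ t)) (ℕ-anti.anti-+ _ _ s))

-- Matchings on consecutive integers

consecutive : ℕ → ℕ → List ℕ
consecutive c zero    = []
consecutive c (suc n) = c ∷ consecutive (suc c) n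

length-consecutive : ∀ c n → length (consecutive c n) ≡ n
length-consecutive c zero    = ≡.refl
length-consecutive c (suc n) = ≡.cong suc (length-consecutive (suc c) n)

tabulate-consecutive : ∀ c {n} (f : Fin n → ℕ) → (∀ i → f i ≡ c ℕ.+ toℕ i) → tabulate f ≡ consecutive c n
tabulate-consecutive c {zero}  f eq = ≡.refl
tabulate-consecutive c {suc n} f eq = ≡.cong₂ _∷_ (≡.trans (eq zero) (ℕ.+-identityʳ c))
  (tabulate-consecutive (suc c) (f ∘ suc) λ i → ≡.trans (eq (suc i)) (ℕ.+-suc c (toℕ i)))

adjacency : ℕ → ℕ → ℕ
adjacency u v = firstRow 0 1 0 ∣ u - v ∣

adjacency-+ : ∀ d c → adjacency c (d ℕ.+ c) ≡ firstRow 0 1 0 d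
adjacency-+ d c = ≡.cong (firstRow 0 1 0) (≡.trans (≡.cong (∣ c -_∣) (ℕ.+-comm d c)) (ℕ.∣m-m+n∣≡n c d))

module PathSquare where
  open Matchings ℕ.+-*-commutativeSemiring {V = ℕ}

  private
    M : ℕ → List ℕ → ℕ
    M = matchSum adjacency

  -- Vertices at distance 3 or more from c contribute zero. Both d and g are general because the
  -- recursion moves away from c while g collects the skipped vertices.
  pickSum-far : ∀ c d n (g : ℕ → List ℕ → ℕ) →
                pickSum (λ u us → adjacency c u ℕ.* g u us) (consecutive (3 ℕ.+ d ℕ.+ c) n) ≡ 0
  pickSum-far c d zero    g = ≡.refl
  pickSum-far c d (suc n) g = ≡.cong₂ ℕ._+_
    (≡.cong (ℕ._* g (3 ℕ.+ d ℕ.+ c) (consecutive (4 ℕ.+ d ℕ.+ c) n)) (adjacency-+ (3 ℕ.+ d) c))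
    (pickSum-far c (suc d) n (λ t ts → g t (3 ℕ.+ d ℕ.+ c ∷ ts)))

  -- The vertex c is uncovered, joined to c + 1, or joined to c + 2; only the last choice leaves a
  -- hole in the list.
  matchSum-consecutive : ∀ k c n → M (suc k) (consecutive c (3 ℕ.+ n)) ≡
    M (suc k) (consecutive (1 ℕ.+ c) (2 ℕ.+ n)) ℕ.+
    (M k (consecutive (2 ℕ.+ c) (1 ℕ.+ n)) ℕ.+ M k (1 ℕ.+ c ∷ consecutive (3 ℕ.+ c) n))
  matchSum-consecutive k c n = ≡.cong (M (suc k) (consecutive (1 ℕ.+ c) (2 ℕ.+ n)) ℕ.+_)
    (≡.cong₂ ℕ._+_
      (≡.trans (≡.cong (ℕ._* M k (consecutive (2 ℕ.+ c) (1 ℕ.+ n))) (adjacency-+ 1 c)) (ℕ.*-identityˡ _))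
      (≡.trans (≡.cong₂ ℕ._+_
        (≡.trans (≡.cong (ℕ._* M k (1 ℕ.+ c ∷ consecutive (3 ℕ.+ c) n)) (adjacency-+ 2 c)) (ℕ.*-identityˡ _))
        (pickSum-far c 0 n (λ t ts → M k (1 ℕ.+ c ∷ 2 ℕ.+ c ∷ ts))))
        (ℕ.+-identityʳ _)))

  -- With c + 1 gone, only c + 2 can be the partner of c. Leaving c uncovered gives the tile of size
  -- 3, joining it gives the crossing pair, and both remainders are consecutive.
  matchSum-gap : ∀ k c n → M (suc k) (c ∷ consecutive (2 ℕ.+ c) (suc n)) ≡
    M (suc k) (consecutive (2 ℕ.+ c) (suc n)) ℕ.+ M k (consecutive (3 ℕ.+ c) n)
  matchSum-gap k c n = ≡.cong (M (suc k) (consecutive (2 ℕ.+ c) (suc n)) ℕ.+_)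
    (≡.trans (≡.cong₂ ℕ._+_
      (≡.trans (≡.cong (ℕ._* M k (consecutive (3 ℕ.+ c) n)) (adjacency-+ 2 c)) (ℕ.*-identityˡ _))
      (pickSum-far c 0 n (λ t ts → M k (2 ℕ.+ c ∷ ts))))
      (ℕ.+-identityʳ _))

  -- Both sides obey the same recurrence, and every recursive call lowers s. Carrying n with an
  -- equation lets it be rewritten with its successors in front, so that `consecutive` unfolds.
  matchSum≡allTilings : ∀ s j c {n} → n ≡ s ℕ.+ j → M j (consecutive c n) ≡ allTilings s j
  matchSum≡allTilings s zero c _ = ≡.sym (allTilings-s-0 s)
  matchSum≡allTilings zero (suc j) c {n} ≡.refl = ≡.trans
    (matchSum-short adjacency (suc j) (consecutive c n)
      (≡.subst (_< 2 ℕ.* suc j) (≡.sym (length-consecutive c n)) (ℕ.m<m+n (suc j) (s≤s z≤n))))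
    (≡.sym (allTilings-0-suc j))
  matchSum≡allTilings 1 1 c ≡.refl = ≡.trans (ℕ.+-identityʳ _)
    (≡.trans (ℕ.*-identityʳ _) (adjacency-+ 1 c))
  matchSum≡allTilings 1 (suc (suc j)) c {n} ≡.refl = ≡.trans
    (matchSum-short adjacency (suc (suc j)) (consecutive c n)
      (≡.subst (_< 2 ℕ.* suc (suc j)) (≡.sym (length-consecutive c n)) bound))
    (≡.sym (allTilings-1-suc-suc j))
    where
    bound : 3 ℕ.+ j < 2 ℕ.* (2 ℕ.+ j)
    bound = ≡.subst (3 ℕ.+ j <_) (≡.sym (ℕ.*-distribˡ-+ 2 2 j)) (ℕ.+-monoʳ-≤ 4 (ℕ.m≤m+n j (j ℕ.+ 0)))
  matchSum≡allTilings (suc (suc s)) 1 c eq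
    with ≡.refl ← ≡.trans eq (≡.cong (2 ℕ.+_) (ℕ.+-suc s 0)) = begin
    M 1 (consecutive c (3 ℕ.+ (s ℕ.+ 0)))
      ≡⟨ matchSum-consecutive 0 c (s ℕ.+ 0) ⟩
    -- The 2 counts the edges from c to c + 1 and c + 2, each completed by the empty matching.
    M 1 (consecutive (1 ℕ.+ c) (2 ℕ.+ (s ℕ.+ 0))) ℕ.+ 2
      ≡⟨ ≡.cong₂ ℕ._+_ (matchSum≡allTilings (suc s) 1 (1 ℕ.+ c) (≡.cong suc (≡.sym (ℕ.+-suc s 0))))
           (≡.sym (≡.cong₂ ℕ._+_ (allTilings-s-0 (suc s)) (allTilings-s-0 s))) ⟩
    allTilings (suc s) 1 ℕ.+ (allTilings (suc s) 0 ℕ.+ allTilings s 0)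
      ≡⟨ allTilings-suc (suc s) 0 ⟨
    allTilings (suc (suc s)) 1 ∎
    where open ≡.≡-Reasoning
  matchSum≡allTilings (suc (suc s)) (suc (suc j)) c eq
    with ≡.refl ← ≡.trans eq (≡.cong (2 ℕ.+_) (≡.trans (ℕ.+-suc s (suc j)) (≡.cong suc (ℕ.+-suc s j)))) = begin
    M (2 ℕ.+ j) (consecutive c (4 ℕ.+ n))
      ≡⟨ matchSum-consecutive (suc j) c (suc n) ⟩
    M (2 ℕ.+ j) (consecutive (1 ℕ.+ c) (3 ℕ.+ n)) ℕ.+
      (M (1 ℕ.+ j) (consecutive (2 ℕ.+ c) (2 ℕ.+ n)) ℕ.+ M (1 ℕ.+ j) (1 ℕ.+ c ∷ consecutive (3 ℕ.+ c) (1 ℕ.+ n)))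
      ≡⟨ ≡.cong₂ ℕ._+_
           (matchSum≡allTilings (suc s) (suc (suc j)) (1 ℕ.+ c)
             (≡.cong suc (≡.sym (≡.trans (ℕ.+-suc s (suc j)) (≡.cong suc (ℕ.+-suc s j))))))
           (≡.cong₂ ℕ._+_
             (matchSum≡allTilings (suc s) (suc j) (2 ℕ.+ c) (≡.cong suc (≡.sym (ℕ.+-suc s j))))
             (≡.trans (matchSum-gap j (1 ℕ.+ c) n) (≡.cong₂ ℕ._+_
               (matchSum≡allTilings s (suc j) (3 ℕ.+ c) (≡.sym (ℕ.+-suc s j)))
               (matchSum≡allTilings s j (4 ℕ.+ c) ≡.refl)))) ⟩
    allTilings (suc s) (suc (suc j)) ℕ.+ (allTilings (suc s) (suc j) ℕ.+ (allTilings s (suc j) ℕ.+ allTilings s j))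
      ≡⟨ allTilings-suc-suc s j ⟨
    allTilings (suc (suc s)) (suc (suc j)) ∎
    where
    open ≡.≡-Reasoning
    n = s ℕ.+ j

-- The ranges of summation in the closed formula

sum-0 : ∀ {n} (f : Fin n → ℕ) → (∀ i → f i ≡ 0) → sum f ≡ 0
sum-0 {zero}  f f≡0 = ≡.refl
sum-0 {suc n} f f≡0 = ≡.cong₂ ℕ._+_ (f≡0 zero) (sum-0 (f ∘ suc) (f≡0 ∘ suc))

-- This covers empty ranges too: if hi < lo, every x lies outside and the longer sum vanishes.
sumFromTo-extend : ∀ lo hi n f → hi ≤ n → (∀ x → x ≤ n → x < lo ⊎ hi < x → f x ≡ 0) →
                   sumFromTo lo hi f ≡ sum {suc n} (f ∘ toℕ)
sumFromTo-extend zero zero n f _ f≡0 = ≡.cong (f 0 ℕ.+_)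
  (≡.sym (sum-0 _ λ i → f≡0 (suc (toℕ i)) (Fin.toℕ<n i) (inj₂ (s≤s z≤n))))
sumFromTo-extend zero (suc hi) (suc n) f (s≤s hi≤n) f≡0 = ≡.cong (f 0 ℕ.+_)
  (sumFromTo-extend zero hi n (f ∘ suc) hi≤n
    λ { x x≤n (inj₂ hi<x) → f≡0 (suc x) (s≤s x≤n) (inj₂ (s≤s hi<x)) })
sumFromTo-extend (suc lo) zero n f _ f≡0 rewrite ℕ.0∸n≡0 lo =
  ≡.sym (sum-0 (f ∘ toℕ) λ i → f≡0 (toℕ i) (ℕ.s≤s⁻¹ (Fin.toℕ<n i)) (outside (toℕ i)))
  where
  outside : ∀ x → x < suc lo ⊎ 0 < x
  outside zero    = inj₁ (s≤s z≤n)
  outside (suc x) = inj₂ (s≤s z≤n)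
sumFromTo-extend (suc lo) (suc hi) (suc n) f (s≤s hi≤n) f≡0 = ≡.trans
  (sumFromTo-extend lo hi n (f ∘ suc) hi≤n
    λ { x x≤n (inj₁ x<lo) → f≡0 (suc x) (s≤s x≤n) (inj₁ (s≤s x<lo))
      ; x x≤n (inj₂ hi<x) → f≡0 (suc x) (s≤s x≤n) (inj₂ (s≤s hi<x)) })
  (≡.cong (ℕ._+ sum {suc n} (f ∘ suc ∘ toℕ)) (≡.sym (f≡0 0 z≤n (inj₁ (s≤s z≤n)))))

tilings-outside : ∀ N q i p → (q ≤ N → i ≤ q → p ≤ i → ⊥) → tilings N q i p ≡ 0
tilings-outside N q i p outside with q ℕ.≤? N
... | no q≰N rewrite k>n⇒nCk≡0 (ℕ.≰⇒> q≰N) = ≡.refl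
... | yes q≤N with i ℕ.≤? q
...   | no i≰q rewrite k>n⇒nCk≡0 (ℕ.≰⇒> i≰q) | ℕ.*-zeroʳ (N C q) = ≡.refl
...   | yes i≤q with p ℕ.≤? i
...     | no p≰i rewrite k>n⇒nCk≡0 (ℕ.≰⇒> p≰i) = ℕ.*-zeroʳ ((N C q) ℕ.* (q C i))
...     | yes p≤i = contradiction p≤i (outside q≤N i≤q)

module _ (s j k : ℕ) (s≡j+2k : s ≡ j ℕ.+ 2 ℕ.* k) where

  private
    term : ℕ → ℕ → ℕ
    term i p = tilings (s ∸ i) (j ∸ p) i p

    -- A nonzero term has q ≤ N, i ≤ q and p ≤ i, where q = j - p and N = s - i. With s = j + 2k the
    -- first reads i - 2k ≤ p, the second p ≤ j - i. The sum is extended only to p ≤ j, where the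
    -- subtraction is exact.
    inner : ∀ i → i ≤ s → sumFromTo (i ∸ 2 ℕ.* k) (i ⊓ (j ∸ i)) (term i) ≡ tilingsBy (s ∸ i) i j
    inner i i≤s = ≡.trans
      (sumFromTo-extend (i ∸ 2 ℕ.* k) (i ⊓ (j ∸ i)) j (term i)
        (ℕ.≤-trans (ℕ.m⊓n≤n i (j ∸ i)) (ℕ.m∸n≤m j i))
        λ p p≤j outside → tilings-outside (s ∸ i) (j ∸ p) i p λ q≤N i≤q p≤i →
          case-outside p p≤j q≤N i≤q p≤i outside)
      (ℕ-anti.∑≈anti (λ p q → tilings (s ∸ i) q i p) j)
      where
      case-outside : ∀ p → p ≤ j → j ∸ p ≤ s ∸ i → i ≤ j ∸ p → p ≤ i →
                     p < i ∸ 2 ℕ.* k ⊎ i ⊓ (j ∸ i) < p → ⊥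
      case-outside p p≤j q≤N i≤q p≤i (inj₁ p<lo) =
        ℕ.<⇒≱ p<lo (ℕ.m≤n+o⇒m∸n≤o i (2 ℕ.* k) (ℕ.+-cancelˡ-≤ j i (2 ℕ.* k ℕ.+ p) (begin
          j ℕ.+ i               ≤⟨ ℕ.+-monoˡ-≤ i (ℕ.≤-reflexive (≡.sym (ℕ.m∸n+n≡m p≤j))) ⟩
          j ∸ p ℕ.+ p ℕ.+ i     ≤⟨ ℕ.+-monoˡ-≤ i (ℕ.+-monoˡ-≤ p q≤N) ⟩
          s ∸ i ℕ.+ p ℕ.+ i     ≡⟨ +-Semigroup.xy∙z≈xz∙y (s ∸ i) p i ⟩
          s ∸ i ℕ.+ i ℕ.+ p     ≡⟨ ≡.cong (ℕ._+ p) (≡.trans (ℕ.m∸n+n≡m i≤s) s≡j+2k) ⟩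
          j ℕ.+ 2 ℕ.* k ℕ.+ p   ≡⟨ ℕ.+-assoc j (2 ℕ.* k) p ⟩
          j ℕ.+ (2 ℕ.* k ℕ.+ p) ∎)))
        where open ℕ.≤-Reasoning
      case-outside p p≤j q≤N i≤q p≤i (inj₂ hi<p) = ℕ.<⇒≱ hi<p (ℕ.⊓-glb p≤i
        (ℕ.m+n≤o⇒m≤o∸n p (≡.subst (_≤ j) (ℕ.+-comm i p) (ℕ.m≤o∸n⇒m+n≤o i p≤j i≤q))))

    -- From i ≤ q ≤ j and i ≤ q ≤ N = s - i come i ≤ j and 2i ≤ s, which are the two upper bounds on
    -- i.
    outer-0 : ∀ i → i ≤ s → j ⊓ (s / 2) < i → tilingsBy (s ∸ i) i j ≡ 0
    outer-0 i i≤s hi<i = ≡.trans (≡.sym (ℕ-anti.∑≈anti (λ p q → tilings (s ∸ i) q i p) j))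
      (sum-0 {suc j} _ λ x → tilings-outside (s ∸ i) (j ∸ toℕ x) i (toℕ x) λ q≤N i≤q _ →
        ℕ.<⇒≱ hi<i (ℕ.⊓-glb (ℕ.≤-trans i≤q (ℕ.m∸n≤m j (toℕ x)))
          (≡.subst (_≤ s / 2) (m*n/n≡m i 2) (/-monoˡ-≤ 2
            (≡.subst (_≤ s) (≡.trans (≡.cong (i ℕ.+_) (≡.sym (ℕ.+-identityʳ i))) (ℕ.*-comm 2 i))
              (ℕ.m≤o∸n⇒m+n≤o i i≤s (ℕ.≤-trans i≤q q≤N)))))))

  restrictedSum≡allTilings :
    sumFromTo 0 (j ⊓ (s / 2)) (λ i → sumFromTo (i ∸ 2 ℕ.* k) (i ⊓ (j ∸ i)) (term i)) ≡ allTilings s j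
  restrictedSum≡allTilings = begin
    sumFromTo 0 (j ⊓ (s / 2)) (λ i → sumFromTo (i ∸ 2 ℕ.* k) (i ⊓ (j ∸ i)) (term i))
      ≡⟨ sumFromTo-extend 0 (j ⊓ (s / 2)) s _ (ℕ.≤-trans (ℕ.m⊓n≤n j (s / 2)) (m/n≤m s 2))
           (λ { i i≤s (inj₂ hi<i) → ≡.trans (inner i i≤s) (outer-0 i i≤s hi<i) }) ⟩
    sum {suc s} (λ x → sumFromTo (toℕ x ∸ 2 ℕ.* k) (toℕ x ⊓ (j ∸ toℕ x)) (term (toℕ x)))
      ≡⟨ sum-cong-≗ {suc s} (λ x → inner (toℕ x) (ℕ.s≤s⁻¹ (Fin.toℕ<n x))) ⟩
    sum {suc s} (λ x → tilingsBy (s ∸ toℕ x) (toℕ x) j)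
      ≡⟨ ℕ-anti.∑≈anti (λ i N → tilingsBy N i j) s ⟩
    allTilings s j ∎
    where open ≡.≡-Reasoning

-- Matchings of a graph, and the hafnian

private
  module ℕ-matchings {v} {V : Set v} = Matchings ℕ.+-*-commutativeSemiring {V = V}
  module ℕ-edges = EdgeSums ℕ.+-*-commutativeSemiring

open ℕ-matchings using () renaming (pickSum to pickSumℕ; matchSum to matchSumℕ)

module _ {a b} {A : Set a} {B : Set b} (f : A → B) where

  pickSum-map : ∀ (g : B → List B → ℕ) vs →
                pickSumℕ g (map f vs) ≡ pickSumℕ (λ u us → g (f u) (map f us)) vs
  pickSum-map g []       = ≡.refl
  pickSum-map g (v ∷ vs) = ≡.cong (g (f v) (map f vs) ℕ.+_) (pickSum-map (λ t ts → g t (f v ∷ ts)) vs)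

  matchSum-map : ∀ (w : B → B → ℕ) k vs → matchSumℕ w k (map f vs) ≡ matchSumℕ (λ u v → w (f u) (f v)) k vs
  matchSum-map w zero    vs       = ≡.refl
  matchSum-map w (suc k) []       = ≡.refl
  matchSum-map w (suc k) (v ∷ vs) = ≡.cong₂ ℕ._+_ (matchSum-map w (suc k) vs)
    (≡.trans (pickSum-map (λ u us → w (f v) u ℕ.* matchSumℕ w k us) vs)
      (ℕ-matchings.pickSum-cong vs λ u us _ → ≡.cong (w (f v) (f u) ℕ.*_) (matchSum-map w k us)))

module _ {n : ℕ} (G : SimpleGraph n) (w : Matrix ℕ n)
         (adj⇒1 : ∀ {i j} → SimpleGraph.Adj G i j → w i j ≡ 1)
         (¬adj⇒0 : ∀ {i j} → ¬ SimpleGraph.Adj G i j → w i j ≡ 0) where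
  open SimpleGraph G

  private
    adjacent? : Decidable (uncurry Adj)
    adjacent? e = adj? (proj₁ e) (proj₂ e)

  weight-indicator⁺ : ∀ {es} → All (uncurry Adj) es → ℕ-edges.weight w es ≡ 1
  weight-indicator⁺ []       = ≡.refl
  weight-indicator⁺ (a ∷ as) = ≡.cong₂ ℕ._*_ (adj⇒1 a) (weight-indicator⁺ as)

  weight-indicator⁻ : ∀ es → ¬ All (uncurry Adj) es → ℕ-edges.weight w es ≡ 0
  weight-indicator⁻ []             ¬all = contradiction [] ¬all
  weight-indicator⁻ ((i , j) ∷ es) ¬all with adj? i j
  ... | no ¬a = ≡.cong (ℕ._* ℕ-edges.weight w es) (¬adj⇒0 ¬a)
  ... | yes a = ≡.trans (≡.cong (w i j ℕ.*_) (weight-indicator⁻ es (¬all ∘ (a ∷_)))) (ℕ.*-zeroʳ (w i j))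

  -- A product of 0-1 weights indicates that all edges belong to the graph, so counting its
  -- matchings becomes a weighted sum over matchings of the complete graph.
  length-filter-adjacent : ∀ {p} {P : List (Pair n) → Set p} (P? : Decidable P) ess →
    length (filter P? (filter (All.all? adjacent?) ess)) ≡ ℕ-edges.listSum (ℕ-edges.weight w) (filter P? ess)
  length-filter-adjacent P? []         = ≡.refl
  length-filter-adjacent P? (es ∷ ess) with All.all? adjacent? es
  ... | yes all with P? es
  ...   | yes _ = ≡.cong₂ ℕ._+_ (≡.sym (weight-indicator⁺ all)) (length-filter-adjacent P? ess)
  ...   | no  _ = length-filter-adjacent P? ess
  length-filter-adjacent P? (es ∷ ess) | no ¬all with P? es
  ...   | yes _ = ≡.cong₂ ℕ._+_ (≡.sym (weight-indicator⁻ es ¬all)) (length-filter-adjacent P? ess)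
  ...   | no  _ = length-filter-adjacent P? ess

  μ≡matchSum : ∀ k → μ k G ≡ matchSumℕ w k (allFin n)
  μ≡matchSum k = begin
    length (matchings k (filter adjacent? (unorderedPairs n)))
      ≡⟨ ≡.cong (length ∘ filter (isMatching? k)) (filter-all-sublists adjacent? (unorderedPairs n)) ⟨
    length (filter (isMatching? k) (filter (All.all? adjacent?) (sublists (unorderedPairs n))))
      ≡⟨ length-filter-adjacent (isMatching? k) (sublists (unorderedPairs n)) ⟩
    ℕ-edges.edgeSum w k (unorderedPairs n)
      ≡⟨ ℕ-edges.edgeSum≈matchSum w k ⟩
    matchSumℕ w k (allFin n) ∎
    where open ≡.≡-Reasoning

firstRow-0-1 : ∀ d → firstRow 0 1 0 d ≢ 1 → firstRow 0 1 0 d ≡ 0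
firstRow-0-1 0                   _  = ≡.refl
firstRow-0-1 1                   ≢1 = contradiction ≡.refl ≢1
firstRow-0-1 2                   ≢1 = contradiction ≡.refl ≢1
firstRow-0-1 (suc (suc (suc d))) _  = ≡.refl

μ-ΓD : ∀ n k → μ k (ΓD n) ≡ matchSumℕ (D n) k (allFin n)
μ-ΓD n = μ≡matchSum (ΓD n) (D n) id (λ {i} {j} → firstRow-0-1 ∣ toℕ i - toℕ j ∣)

μ-ΓD≡allTilings : ∀ s j → μ j (ΓD (s ℕ.+ j)) ≡ allTilings s j
μ-ΓD≡allTilings s j = begin
  μ j (ΓD (s ℕ.+ j))                                  ≡⟨ μ-ΓD (s ℕ.+ j) j ⟩
  matchSumℕ (D (s ℕ.+ j)) j (allFin (s ℕ.+ j))        ≡⟨ matchSum-map toℕ adjacency j (allFin (s ℕ.+ j)) ⟨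
  matchSumℕ adjacency j (map toℕ (allFin (s ℕ.+ j)))
    ≡⟨ ≡.cong (matchSumℕ adjacency j) (≡.trans (map-tabulate id toℕ)
         (tabulate-consecutive 0 toℕ λ _ → ≡.refl)) ⟩
  matchSumℕ adjacency j (consecutive 0 (s ℕ.+ j))     ≡⟨ PathSquare.matchSum≡allTilings s j 0 ≡.refl ⟩
  allTilings s j                                      ∎
  where open ≡.≡-Reasoning

module Scaling {c ℓ} (S : CommutativeSemiring c ℓ) {v} {V : Set v} (x : CommutativeSemiring.Carrier S) where
  open CommutativeSemiring S hiding (zero)
  open SemiringMult semiring using (×-homo-+; ×-assocˡ; ×-comm-*; ×-assoc-*; ×-congʳ) renaming (_×_ to _·_)
  open Exp semiring using (_^_)
  open Matchings S {V = V}
  open SetoidReasoning setoid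

  pickSum-multiples : ∀ (f : V → List V → ℕ) y vs → pickSum (λ u us → f u us · y) vs ≈ pickSumℕ f vs · y
  pickSum-multiples f y []       = refl
  pickSum-multiples f y (v ∷ vs) = trans (+-congˡ (pickSum-multiples _ y vs)) (sym (×-homo-+ y (f v vs) _))

  -- Homogeneity: each of the k edges contributes one factor x, and the counting stays in the
  -- natural numbers.
  matchSum-multiples : ∀ (w : V → V → ℕ) k vs →
                       matchSum (λ u v → w u v · x) k vs ≈ matchSumℕ w k vs · x ^ k
  matchSum-multiples w zero    vs       = sym (+-identityʳ 1#)
  matchSum-multiples w (suc k) []       = refl
  matchSum-multiples w (suc k) (v ∷ vs) = begin
    matchSum (λ u v → w u v · x) (suc k) vs + pickSum (λ u us → (w v u · x) * matchSum (λ u v → w u v · x) k us) vs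
      ≈⟨ +-cong (matchSum-multiples w (suc k) vs) (pickSum-cong vs λ u us _ →
           trans (*-congˡ (matchSum-multiples w k us)) (product (w v u) (matchSumℕ w k us))) ⟩
    matchSumℕ w (suc k) vs · x ^ suc k + pickSum (λ u us → (w v u ℕ.* matchSumℕ w k us) · x ^ suc k) vs
      ≈⟨ +-congˡ (pickSum-multiples _ (x ^ suc k) vs) ⟩
    matchSumℕ w (suc k) vs · x ^ suc k + pickSumℕ (λ u us → w v u ℕ.* matchSumℕ w k us) vs · x ^ suc k
      ≈⟨ ×-homo-+ (x ^ suc k) (matchSumℕ w (suc k) vs) _ ⟨
    matchSumℕ w (suc k) (v ∷ vs) · x ^ suc k ∎
    where
    product : ∀ m n → (m · x) * (n · x ^ k) ≈ (m ℕ.* n) · x ^ suc k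
    product m n = begin
      (m · x) * (n · x ^ k)   ≈⟨ ×-assoc-* m x (n · x ^ k) ⟩
      m · (x * (n · x ^ k))   ≈⟨ ×-congʳ m (×-comm-* n x (x ^ k)) ⟩
      m · (n · (x * x ^ k))   ≈⟨ ×-assocˡ (x * x ^ k) m n ⟩
      (m ℕ.* n) · x ^ suc k   ∎

module _ {c ℓ} (R : CommutativeRing c ℓ) where
  open CommutativeRing R hiding (zero)
  open Sum +-monoid using (sum⁺-syntax)
  open SemiringMult semiring using (×-congˡ; ×-congʳ; ×-comm-*; ×-assocˡ) renaming (_×_ to _·_)
  open Exp semiring using (_^_)
  open Antidiagonal commutativeSemiring
  open Matchings commutativeSemiring
  open EdgeSums commutativeSemiring
  open SetoidReasoning setoid

  module _ (a b : Carrier) where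

    -- On the diagonal the entry is 0, while the right-hand side would be b. The edges summed over
    -- join i < j, so their distance is never 0.
    firstRow-split : ∀ d → d ≢ 0 → firstRow 0# a b d ≈ b + firstRow 0 1 0 d · (a - b)
    firstRow-split 0 d≢0 = contradiction ≡.refl d≢0
    firstRow-split 1 _ = sym (trans (+-congˡ (+-identityʳ _)) (trans (sym (+-assoc b a (- b))) (xyx⁻¹≈y b a)))
      where open AbelianGroup +-abelianGroup using (xyx⁻¹≈y)
    firstRow-split 2 _ = firstRow-split 1 λ ()
    firstRow-split (suc (suc (suc _))) _ = sym (+-identityʳ b)

    hafnian-D : ∀ m → hafnian R (D[_,_] R a b (2 ℕ.* m)) ≈
      ∑[ k ≤ m ] ((pairings (toℕ k) ℕ.* μ (m ∸ toℕ k) (ΓD (2 ℕ.* m))) · ((a - b) ^ (m ∸ toℕ k) * b ^ toℕ k))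
    hafnian-D m = begin
      hafnian R A
        ≡⟨ ≡.cong (listSum (weight A)) (pairPartitions≡matchings m) ⟩
      edgeSum A m (unorderedPairs n)
        ≈⟨ listSum-cong (All.filter⁺ (isMatching? m) (All.map weight-split (all-sublists (unorderedPairs-< n)))) ⟩
      edgeSum w m (unorderedPairs n)
        ≈⟨ edgeSum≈matchSum w m ⟩
      matchSum w m (allFin n)
        ≈⟨ matchSum-perfect w w′ b (λ _ _ → refl) m (allFin n) (length-tabulate {n = n} id) ⟩
      anti (λ k j → oddFactorial k · (b ^ k * matchSum w′ j (allFin n))) m
        ≈⟨ anti-cong m (λ k j _ → summand k j) ⟩
      anti (λ k j → (pairings k ℕ.* μ j (ΓD n)) · ((a - b) ^ j * b ^ k)) m
        ≈⟨ ∑≈anti _ m ⟨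
      (∑[ k ≤ m ] ((pairings (toℕ k) ℕ.* μ (m ∸ toℕ k) (ΓD n)) · ((a - b) ^ (m ∸ toℕ k) * b ^ toℕ k))) ∎
      where
      n = 2 ℕ.* m
      A = D[_,_] R a b n
      w w′ : Matrix Carrier n
      w′ i j = D n i j · (a - b)
      w i j = b + w′ i j

      weight-split : ∀ {es} → All (uncurry Fin._<_) es → weight A es ≈ weight w es
      weight-split <s = weight-cong {w = A} {w′ = w} (All.map
        (λ {e} i<j → firstRow-split ∣ toℕ (proj₁ e) - toℕ (proj₂ e) ∣ λ d≡0 →
          ℕ.<⇒≢ i<j (ℕ.∣m-n∣≡0⇒m≡n d≡0)) <s)

      summand : ∀ k j → oddFactorial k · (b ^ k * matchSum w′ j (allFin n)) ≈
                (pairings k ℕ.* μ j (ΓD n)) · ((a - b) ^ j * b ^ k)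
      summand k j = begin
        oddFactorial k · (b ^ k * matchSum w′ j (allFin n))
          ≈⟨ ×-congʳ (oddFactorial k) (trans
               (*-congˡ (Scaling.matchSum-multiples commutativeSemiring (a - b) (D n) j (allFin n)))
               (×-comm-* (matchSumℕ (D n) j (allFin n)) _ _)) ⟩
        oddFactorial k · (matchSumℕ (D n) j (allFin n) · (b ^ k * (a - b) ^ j))
          ≈⟨ ×-assocˡ _ (oddFactorial k) _ ⟩
        (oddFactorial k ℕ.* matchSumℕ (D n) j (allFin n)) · (b ^ k * (a - b) ^ j)
          ≈⟨ ×-congʳ (oddFactorial k ℕ.* matchSumℕ (D n) j (allFin n)) (*-comm _ _) ⟩
        (oddFactorial k ℕ.* matchSumℕ (D n) j (allFin n)) · ((a - b) ^ j * b ^ k)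
          ≈⟨ ×-congˡ (≡.cong₂ ℕ._*_ (pairings≡oddFactorial k) (μ-ΓD n j)) ⟨
        (pairings k ℕ.* μ j (ΓD n)) · ((a - b) ^ j * b ^ k) ∎

theorem3 : ∀ {c ℓ} (R : CommutativeRing c ℓ) (let open CommutativeRing R)
    (let open Sum +-monoid using (sum⁺-syntax))
    (let open Mult +-monoid using () renaming (_×_ to _·_))
    (let open Exp semiring using (_^_))
    (a b : Carrier) (m : ℕ) .{{_ : NonZero m}} →
    (hafnian R (D[_,_] R a b (2 ℕ.* m)) ≈
    ∑[ k ≤ m ] ((pairings (toℕ k) ℕ.* μ (m ∸ toℕ k) (ΓD (2 ℕ.* m)))
    · ((a - b) ^ (m ∸ toℕ k) * b ^ toℕ k)))
    ×
    (∀ k → k ≤ m →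
    μ (m ∸ k) (ΓD (2 ℕ.* m)) ≡
    ∑[ i ∈ 0 ⋯ (m ∸ k) ⊓ ((m ℕ.+ k) / 2) ]
    ∑[ p ∈ i ∸ 2 ℕ.* k ⋯ i ⊓ (m ∸ k ∸ i) ]
    ((m ℕ.+ k ∸ i) C (m ∸ k ∸ p)) ℕ.* ((m ∸ k ∸ p) C i) ℕ.* (i C p))
theorem3 R a b m = hafnian-D R a b m , λ k k≤m → begin
  μ (m ∸ k) (ΓD (2 ℕ.* m))
    ≡⟨ ≡.cong (μ (m ∸ k) ∘ ΓD) (vertices k k≤m) ⟩
  μ (m ∸ k) (ΓD (m ℕ.+ k ℕ.+ (m ∸ k)))
    ≡⟨ μ-ΓD≡allTilings (m ℕ.+ k) (m ∸ k) ⟩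
  allTilings (m ℕ.+ k) (m ∸ k)
    ≡⟨ restrictedSum≡allTilings (m ℕ.+ k) (m ∸ k) k (tiles k k≤m) ⟨
  _ ∎
  where
  open ≡.≡-Reasoning
  -- A matching with j = m - k edges on 2m vertices has excess s = 2m - j = m + k, and s - j = 2k is
  -- the shift in the lower bound on p.
  vertices : ∀ k → k ≤ m → 2 ℕ.* m ≡ m ℕ.+ k ℕ.+ (m ∸ k)
  vertices k k≤m = ≡.trans (≡.cong (m ℕ.+_) (≡.trans (ℕ.+-identityʳ m) (≡.sym (ℕ.m+[n∸m]≡n k≤m))))
    (≡.sym (ℕ.+-assoc m k (m ∸ k)))
  tiles : ∀ k → k ≤ m → m ℕ.+ k ≡ m ∸ k ℕ.+ 2 ℕ.* k
  tiles k k≤m = ≡.trans (≡.cong (ℕ._+ k) (≡.sym (ℕ.m∸n+n≡m k≤m)))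
    (≡.trans (ℕ.+-assoc (m ∸ k) k k) (≡.cong (λ x → m ∸ k ℕ.+ (k ℕ.+ x)) (≡.sym (ℕ.+-identityʳ k))))
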